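{- Let $n\equiv 3\pmod 4$ with $n>3$. Let $1\le r\le m$, let $M_r\in\mathfrak{C}_r$, and suppose $\det\tilde M_r>0$. Let $E_m^*\in\mathfrak{E}_m$ satisfy $\det E_m^*=\max\{\det E: E\in\mathfrak{E}_m\}$, and write $$E_m^*=\begin{bmatrix}M_r & B\\ B^T & A\end{bmatrix}$$ with $A=(a_{ij})$ of order $m-r$ and $B$ of size $r\times(m-r)$. If $a_{ij}=3$ for some $i\neq j$, then columns $i$ and $j$ of $B$ are equal, and columns $i$ and $j$ of $A$ are equal except for their $i$-th and $j$-th entries.
   Context: Fix an integer $n\equiv 3\pmod 4$, $n>3$. For $m\ge1$, $\mathfrak{C}_m$ is the set of symmetric positive definite $m\times m$ integer matrices $C=(c_{ij})$ with $c_{ii}=n$ and $c_{ij}\equiv n\pmod 4$ for all $i,j$. Given a fixed $M_r\in\mathfrak{C}_r$, for $m\ge r$, $\mathfrak{E}_m$ is the set of $E_m\in\mathfrak{C}_m$ whose leading $r\times r$ submatrix is $M_r$. For a square matrix $C$ of order $m$, $\tilde C$ denotes the matrix obtained from $C$ by replacing its $(m,m)$ entry by $3$. -}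

module Defs where

open import Data.Fin using (Fin; zero; suc; toℕ; fromℕ; _↑ˡ_; _↑ʳ_)
open import Data.Integer using (ℤ; +_; 0ℤ; 1ℤ; -1ℤ; _+_; _-_; _*_; _^_; _≤_; _<_)
open import Data.Integer.Divisibility.Signed using (_∣_)
open import Data.Integer.Properties using (+-*-semiring)
open import Data.Nat as ℕ using (ℕ)
open import Data.Product using (_×_)
open import Data.Vec.Functional using (Vector; removeAt; updateAt; transpose)
open import Function using (const)
open import Relation.Binary.PropositionalEquality using (_≡_)
open import Relation.Nullary using (¬_)

open import Algebra.Properties.Semiring.Sum +-*-semiring public using (sum)

infix 4 _≡_[mod_]

_≡_[mod_] : ℤ → ℤ → ℤ → Set
a ≡ b [mod d ] = d ∣ a - b

-- Matrices are functions, so equality of matrices is always stated entrywise.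
Matrix : ℕ → ℕ → Set
Matrix p q = Vector (Vector ℤ q) p

SqMatrix : ℕ → Set
SqMatrix m = Matrix m m

minor : ∀ {p q} → Matrix (ℕ.suc p) (ℕ.suc q) → Fin (ℕ.suc p) → Fin (ℕ.suc q) → Matrix p q
minor C i j a = removeAt (removeAt C i a) j

-- Laplace expansion along the first row.
det : ∀ {m} → SqMatrix m → ℤ
det {ℕ.zero}  C = 1ℤ
det {ℕ.suc m} C = sum λ j → (-1ℤ ^ toℕ j) * C zero j * det (minor C zero j)

quadraticForm : ∀ {m} → SqMatrix m → Vector ℤ m → ℤ
quadraticForm C x = sum λ i → sum λ j → x i * C i j * x j

Symmetric : ∀ {m} → SqMatrix m → Set
Symmetric C = ∀ i j → C i j ≡ transpose C i j

-- For symmetric C, the only case used below, this agrees with quantifying over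
-- nonzero real vectors.  Clearing denominators passes from ℤ to ℚ, and by density
-- the form is then positive semidefinite over ℝ; were it not definite, C would be
-- singular and have a nonzero rational kernel vector.
PositiveDefinite : ∀ {m} → SqMatrix m → Set
PositiveDefinite C = ∀ x → ¬ (∀ i → x i ≡ 0ℤ) → 0ℤ < quadraticForm C x

record ℭ (n : ℤ) {m : ℕ} (C : SqMatrix m) : Set where
  field
    symmetric        : Symmetric C
    positiveDefinite : PositiveDefinite C
    diagonal         : ∀ i → C i i ≡ n
    congruent        : ∀ i j → C i j ≡ n [mod + 4 ]

-- The blocks of a square matrix of order r + k, split after the first r indices.

topLeft : ∀ r {k} → SqMatrix (r ℕ.+ k) → SqMatrix r
topLeft r {k} E i j = E (i ↑ˡ k) (j ↑ˡ k)

topRight : ∀ r {k} → SqMatrix (r ℕ.+ k) → Matrix r k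
topRight r {k} E i j = E (i ↑ˡ k) (r ↑ʳ j)

bottomRight : ∀ r {k} → SqMatrix (r ℕ.+ k) → SqMatrix k
bottomRight r E i j = E (r ↑ʳ i) (r ↑ʳ j)

-- 𝔈 n M E presents the order m ≥ r as r + k.
record 𝔈 (n : ℤ) {r k : ℕ} (M : SqMatrix r) (E : SqMatrix (r ℕ.+ k)) : Set where
  field
    inℭ     : ℭ n E
    leading : ∀ i j → topLeft r E i j ≡ M i j

tilde : ∀ {m} → SqMatrix (ℕ.suc m) → SqMatrix (ℕ.suc m)
tilde {m} C = updateAt C (fromℕ m) λ row → updateAt row (fromℕ m) (const (+ 3))

MaximalDet : (n : ℤ) {r k : ℕ} (M : SqMatrix r) (E : SqMatrix (r ℕ.+ k)) → Set
MaximalDet n {r} {k} M E* =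
  𝔈 n M E* × (∀ (E : SqMatrix (r ℕ.+ k)) → 𝔈 n M E → det E ≤ det E*)

{-# OPTIONS --safe #-}
module Submission where

open import Defs
open import Data.Empty using (⊥)
open import Data.Fin using (Fin; zero; suc; toℕ; fromℕ; punchIn; punchOut; splitAt; _↑ˡ_; _↑ʳ_)
open import Data.Fin.Permutation as P using (Permutation; _⟨$⟩ʳ_; _⟨$⟩ˡ_; inverseˡ; inverseʳ; remove)
open import Data.Fin.Properties
  using (all?; punchInᵢ≢i; punchIn-punchOut; splitAt-↑ˡ; splitAt-↑ʳ; ↑ʳ-injective; +↔⊎)
open import Data.Integer hiding (suc; sign)
open import Data.Integer.Divisibility.Signed using (_∣_; divides; ∣m⇒∣-m)
open import Data.Integer.Properties
open import Algebra.Properties.Semiring.Sum +-*-semiring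
  using (sum-cong-≗; ∑-distrib-+; ∑-comm; *-distribˡ-sum; sum-permute)
open import Data.Integer.Tactic.RingSolver using (solve-∀)
open import Data.Nat as ℕ using (ℕ)
open import Data.Product using (_×_; _,_; proj₁; proj₂; ∃-syntax; Σ-syntax)
open import Data.Sum.Algebra using (⊎-comm)
open import Data.Sum.Function.Propositional using (_⊎-↔_)
open import Data.Vec.Functional using (Vector; _∷_; tail; transpose)
open import Data.Vec.Functional.Properties using (updateAt-updates; updateAt-minimal)
open import Function using (_∘_; _$_)
open import Function.Properties.Inverse using (↔-sym; ↔-trans)
open import Relation.Binary.PropositionalEquality
open import Relation.Nullary using (¬_; Dec; yes; no; contradiction)
open import Relation.Nullary.Decidable using (decidable-stable)
open ≡-Reasoning

-- Write h = n - 3.  Let D be E* without the indices i and j, let x and y be the rest of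
-- their columns, δ = det D, α = δ (n - xᵀD⁻¹x), β = δ (n - yᵀD⁻¹y), γ = δ (3 - xᵀD⁻¹y).
-- Then δ det E* = αβ - γ², and positivity of (x - y)ᵀD⁻¹(x - y) reads α + β < 2γ + 2hδ
-- unless x = y.  Replacing y by x gives a matrix of determinant h (2α - hδ).  If
-- α + β ≥ 2hδ and α ≥ β, that matrix lies in 𝔈, and its determinant exceeds det E* when
-- x ≠ y; the case β ≥ α is symmetric.  If α + β < 2hδ, then det E* < h²δ; but every matrix F
-- in 𝔈 can be enlarged by one index within 𝔈 to a matrix of determinant at least h det F
-- (this is where det M̃ > 0 is used), so doing this twice to D again beats E*.

-- The obstacle is positive definiteness: duplicating an index may leave the class. With the two
-- copies joined by 3, which is congruent to n, the quadratic form splits into h (s² + t²) plus the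
-- form of the matrix whose duplicated diagonal entry is lowered to 3. So it is enough that one
-- determinant, `det₃`, be nonnegative. For the matrix bordered by x it equals α - hδ, which
-- explains the threshold 2hδ for α + β: from there on, the larger of the two can be copied.
-- Enlarging F meets the same obstacle. If `det₃ F` is negative, then det F = `det₃ F` + h det
-- (`inner F`) shows that dropping the first index costs at most a factor h, so the smaller matrix
-- may be enlarged twice instead. The descent ends at the fixed block, where the sign is given, and
-- `det₃ (copy n C)` = h `det₃ C` keeps later copies admissible. All of this runs over the integers:
-- D⁻¹x appears as u with D u = d x and d > 0. Expansions and induction work on index 0, so the
-- fixed block is moved behind the others and its last index is made its first.

private variable
  m p q : ℕ

-- Determinants: transposition, permutation of indices, row operations.

infix 4 _≋_

_≋_ : Matrix p q → Matrix p q → Set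
A ≋ B = ∀ i j → A i j ≡ B i j

sign : Fin m → ℤ
sign i = -1ℤ ^ toℕ i

det-cong : (A B : SqMatrix m) → A ≋ B → det A ≡ det B
det-cong {ℕ.zero}  A B A≋B = refl
det-cong {ℕ.suc m} A B A≋B = sum-cong-≗ λ j →
  cong₂ (λ a d → sign j * a * d) (A≋B zero j)
    (det-cong (minor A zero j) (minor B zero j) λ a b → A≋B (suc a) (punchIn j b))

-- Apart from the common corner term, expanding the first-row minors along their first column and
-- the first-column minors along their first row gives the same double sum over a row and a column.
det-column : (A : SqMatrix (ℕ.suc m)) →
  det A ≡ sum λ i → sign i * A i zero * det (minor A i zero)
det-column {ℕ.zero}  A = refl
det-column {ℕ.suc m} A = cong (_+_ (1ℤ * A zero zero * det (minor A zero zero))) (begin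
  sum (λ j → sign (suc j) * A zero (suc j) * det (minor A zero (suc j)))
    ≡⟨ sum-cong-≗ (λ j → trans
         (cong (sign (suc j) * A zero (suc j) *_) (det-column (minor A zero (suc j))))
         (*-distribˡ-sum (sign (suc j) * A zero (suc j))
            (λ i → sign i * A (suc i) zero * minor² i j))) ⟩
  sum (λ j → sum λ i → sign (suc j) * A zero (suc j) * (sign i * A (suc i) zero * minor² i j))
    ≡⟨ ∑-comm (λ j i → sign (suc j) * A zero (suc j) * (sign i * A (suc i) zero * minor² i j)) ⟩
  sum (λ i → sum λ j → sign (suc j) * A zero (suc j) * (sign i * A (suc i) zero * minor² i j))
    ≡⟨ sum-cong-≗ (λ i → sum-cong-≗ λ j →
         exchange (sign j) (A zero (suc j)) (sign i) (A (suc i) zero) (minor² i j)) ⟩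
  sum (λ i → sum λ j → sign (suc i) * A (suc i) zero * (sign j * A zero (suc j) * minor² i j))
    ≡⟨ sum-cong-≗ (λ i → *-distribˡ-sum (sign (suc i) * A (suc i) zero)
            (λ j → sign j * A zero (suc j) * minor² i j)) ⟨
  sum (λ i → sign (suc i) * A (suc i) zero * det (minor A (suc i) zero)) ∎)
  where
  minor² : Fin (ℕ.suc m) → Fin (ℕ.suc m) → ℤ
  minor² i j = det (λ a b → A (suc (punchIn i a)) (suc (punchIn j b)))

  exchange : ∀ s a t b d → -1ℤ * s * a * (t * b * d) ≡ -1ℤ * t * b * (s * a * d)
  exchange = solve-∀

det-transpose : (A : SqMatrix m) → det (transpose A) ≡ det A
det-transpose {ℕ.zero}  A = refl
det-transpose {ℕ.suc m} A = trans
  (sum-cong-≗ λ j → cong (sign j * A j zero *_) (det-transpose (minor A j zero)))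
  (sym (det-column A))

swap₀₁ : ∀ {A : Set} → Vector A (2 ℕ.+ m) → Vector A (2 ℕ.+ m)
swap₀₁ v zero          = v (suc zero)
swap₀₁ v (suc zero)    = v zero
swap₀₁ v (suc (suc i)) = v (suc (suc i))

-- In the expansion along the first column the terms of rows 0 and 1 trade places with opposite
-- signs. Every other minor still has both rows on top, so induction applies to it.
det-swap₀₁ : (A : SqMatrix (2 ℕ.+ m)) → det (swap₀₁ A) ≡ - det A
det-swap₀₁ {m} A = begin
  det (swap₀₁ A)
    ≡⟨ det-column (swap₀₁ A) ⟩
  1ℤ * a₁ * det (minor (swap₀₁ A) zero zero) +
  (-1ℤ * a₀ * det (minor (swap₀₁ A) (suc zero) zero) + sum swapped)
    ≡⟨ cong₂ (λ d e → 1ℤ * a₁ * d + (-1ℤ * a₀ * e + sum swapped))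
         (det-cong (minor (swap₀₁ A) zero zero) (minor A (suc zero) zero)
           λ { zero b → refl ; (suc a) b → refl })
         (det-cong (minor (swap₀₁ A) (suc zero) zero) (minor A zero zero)
           λ { zero b → refl ; (suc a) b → refl }) ⟩
  1ℤ * a₁ * d₁ + (-1ℤ * a₀ * d₀ + sum swapped)
    ≡⟨ cong (λ e → 1ℤ * a₁ * d₁ + (-1ℤ * a₀ * d₀ + e))
         (trans (sum-cong-≗ swapped≗) (sym (*-distribˡ-sum -1ℤ original))) ⟩
  1ℤ * a₁ * d₁ + (-1ℤ * a₀ * d₀ + -1ℤ * sum original)
    ≡⟨ rearrange a₁ d₁ a₀ d₀ (sum original) ⟩
  - (1ℤ * a₀ * d₀ + (-1ℤ * a₁ * d₁ + sum original))
    ≡⟨ cong -_ (det-column A) ⟨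
  - det A ∎
  where
  a₀ a₁ d₀ d₁ : ℤ
  a₀ = A zero zero
  a₁ = A (suc zero) zero
  d₀ = det (minor A zero zero)
  d₁ = det (minor A (suc zero) zero)

  original swapped : Vector ℤ m
  original i = sign (suc (suc i)) * A (suc (suc i)) zero * det (minor A (suc (suc i)) zero)
  swapped  i = sign (suc (suc i)) * A (suc (suc i)) zero * det (minor (swap₀₁ A) (suc (suc i)) zero)

  rearrange : ∀ a d b e r →
    1ℤ * a * d + (-1ℤ * b * e + -1ℤ * r) ≡ - (1ℤ * b * e + (-1ℤ * a * d + r))
  rearrange = solve-∀

  pull-out : ∀ x y → x * - y ≡ -1ℤ * (x * y)
  pull-out = solve-∀

  minor-swap : ∀ {m} (A : SqMatrix (2 ℕ.+ m)) (i : Fin m) →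
    det (minor (swap₀₁ A) (suc (suc i)) zero) ≡ - det (minor A (suc (suc i)) zero)
  minor-swap {ℕ.suc m} A i = trans
    (det-cong (minor (swap₀₁ A) (suc (suc i)) zero) (swap₀₁ (minor A (suc (suc i)) zero))
      λ { zero b → refl ; (suc zero) b → refl ; (suc (suc a)) b → refl })
    (det-swap₀₁ (minor A (suc (suc i)) zero))

  swapped≗ : ∀ i → swapped i ≡ -1ℤ * original i
  swapped≗ i = trans
    (cong (sign (suc (suc i)) * A (suc (suc i)) zero *_) (minor-swap A i))
    (pull-out (sign (suc (suc i)) * A (suc (suc i)) zero) (det (minor A (suc (suc i)) zero)))

toFront : ∀ {A : Set} → Fin (ℕ.suc m) → Vector A (ℕ.suc m) → Vector A (ℕ.suc m)
toFront i v = v i ∷ λ a → v (punchIn i a)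

-- Carries a row operation on the lower rows past a common first row `w`: the operation is known on
-- each minor, one size smaller.
det-∷-scale : ∀ s w (R S : Matrix m (ℕ.suc m)) →
  (∀ j → det (minor (w ∷ R) zero j) ≡ s * det (minor (w ∷ S) zero j)) →
  det (w ∷ R) ≡ s * det (w ∷ S)
det-∷-scale s w R S eq = trans
  (sum-cong-≗ λ j → trans (cong (sign j * w j *_) (eq j))
    (pull-out (sign j * w j) s (det (minor (w ∷ S) zero j))))
  (sym (*-distribˡ-sum s λ j → sign j * w j * det (minor (w ∷ S) zero j)))
  where
  pull-out : ∀ x s d → x * (s * d) ≡ s * (x * d)
  pull-out = solve-∀

∷-η : (A : Matrix (ℕ.suc p) q) → A ≋ A zero ∷ tail A
∷-η A zero    j = refl
∷-η A (suc i) j = refl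

-- Row `suc i` first moves to the front of the tail, by induction, and then changes places with row
-- 0; the exchange gives the extra factor -1.
det-toFront : ∀ i (A : SqMatrix (ℕ.suc m)) → det (toFront i A) ≡ sign i * det A
det-toFront zero A = trans
  (det-cong (toFront zero A) A λ { zero b → refl ; (suc a) b → refl })
  (sym (*-identityˡ (det A)))
det-toFront {ℕ.suc m} (suc i) A = begin
  det (toFront (suc i) A)
    ≡⟨ det-cong (toFront (suc i) A) (swap₀₁ (A zero ∷ toFront i (tail A)))
         (λ { zero b → refl ; (suc zero) b → refl ; (suc (suc a)) b → refl }) ⟩
  det (swap₀₁ (A zero ∷ toFront i (tail A)))
    ≡⟨ det-swap₀₁ (A zero ∷ toFront i (tail A)) ⟩
  - det (A zero ∷ toFront i (tail A))
    ≡⟨ cong -_ (det-∷-scale (sign i) (A zero) (toFront i (tail A)) (tail A) λ j →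
         trans
           (det-cong (minor (A zero ∷ toFront i (tail A)) zero j) (toFront i (minor A zero j))
             λ { zero b → refl ; (suc a) b → refl })
           (det-toFront i (minor A zero j))) ⟩
  - (sign i * det (A zero ∷ tail A))
    ≡⟨ cong (λ d → - (sign i * d)) (det-cong A (A zero ∷ tail A) (∷-η A)) ⟨
  - (sign i * det A)
    ≡⟨ neg-* (sign i) (det A) ⟩
  -1ℤ * sign i * det A ∎
  where
  neg-* : ∀ s d → - (s * d) ≡ -1ℤ * s * d
  neg-* = solve-∀

sign² : (i : Fin m) → sign i * sign i ≡ 1ℤ
sign² zero    = refl
sign² (suc i) = trans (square-neg (sign i)) (sign² i)
  where
  square-neg : ∀ s → -1ℤ * s * (-1ℤ * s) ≡ s * s
  square-neg = solve-∀

-- The sign is left abstract: `det-reindex` applies it once to rows and once to columns, so only its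
-- square matters. It must not depend on `A`, since the same `s` serves all minors and also the
-- transpose.
det-permuteRows : (π : Permutation m m) →
  ∃[ s ] s * s ≡ 1ℤ × (∀ A → det (λ i → A (π ⟨$⟩ʳ i)) ≡ s * det A)
det-permuteRows {ℕ.zero}  π = 1ℤ , refl , λ A → refl
det-permuteRows {ℕ.suc m} π with det-permuteRows (remove zero π)
... | s , s² , rows = s * sign i , trans (square (sign i) s) (cong₂ _*_ s² (sign² i)) , λ A → begin
  det (λ a → A (π ⟨$⟩ʳ a))
    ≡⟨ det-cong (λ a → A (π ⟨$⟩ʳ a)) (A i ∷ λ a → A (punchIn i (remove zero π ⟨$⟩ʳ a)))
         (λ { zero b → refl ; (suc a) b → cong (λ c → A c b) (P.punchIn-permute π zero a) }) ⟩
  det (A i ∷ λ a → A (punchIn i (remove zero π ⟨$⟩ʳ a)))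
    ≡⟨ det-∷-scale s (A i) (λ a → A (punchIn i (remove zero π ⟨$⟩ʳ a))) (λ a → A (punchIn i a))
         (λ j → rows (minor (toFront i A) zero j)) ⟩
  s * det (toFront i A)
    ≡⟨ cong (s *_) (det-toFront i A) ⟩
  s * (sign i * det A)
    ≡⟨ *-assoc s (sign i) (det A) ⟨
  s * sign i * det A ∎
  where
  i : Fin (ℕ.suc m)
  i = π ⟨$⟩ʳ zero

  square : ∀ t s → s * t * (s * t) ≡ (s * s) * (t * t)
  square = solve-∀

reindex : (Fin p → Fin q) → SqMatrix q → SqMatrix p
reindex f A i j = A (f i) (f j)

det-reindex : (π : Permutation p q) (A : SqMatrix q) → det (reindex (π ⟨$⟩ʳ_) A) ≡ det A
det-reindex π A with refl ← P.↔⇒≡ π with s , s² , rows ← det-permuteRows π = begin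
  det (reindex f A)                           ≡⟨ rows (λ a b → A a (f b)) ⟩
  s * det (λ a b → A a (f b))                 ≡⟨ cong (s *_) (det-transpose (λ a b → A a (f b))) ⟨
  s * det (λ a b → A b (f a))                 ≡⟨ cong (s *_) (rows (transpose A)) ⟩
  s * (s * det (transpose A))                 ≡⟨ *-assoc s s (det (transpose A)) ⟨
  s * s * det (transpose A)                   ≡⟨ cong₂ _*_ s² (det-transpose A) ⟩
  1ℤ * det A                                  ≡⟨ *-identityˡ (det A) ⟩
  det A                                       ∎
  where f = π ⟨$⟩ʳ_

det-row₀≡row₁ : (A : SqMatrix (2 ℕ.+ m)) → (∀ j → A zero j ≡ A (suc zero) j) → det A ≡ 0ℤ
det-row₀≡row₁ A eq = self-neg (det A) (trans
  (det-cong A (swap₀₁ A) λ { zero b → eq b ; (suc zero) b → sym (eq b) ; (suc (suc a)) b → refl })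
  (det-swap₀₁ A))
  where
  self-neg : ∀ d → d ≡ - d → d ≡ 0ℤ
  self-neg (+ ℕ.zero) eq = refl

det-row₀≡row : (R : Matrix m (ℕ.suc m)) (k : Fin m) → det (R k ∷ R) ≡ 0ℤ
det-row₀≡row {ℕ.suc m} R k = begin
  det (R k ∷ R)
    -- A factor `sign k * sign k` is inserted, one half of which pays for moving row `k` of `R` to
    -- the top of `R`, next to its duplicate.
    ≡⟨ *-identityˡ (det (R k ∷ R)) ⟨
  1ℤ * det (R k ∷ R)
    ≡⟨ cong (_* det (R k ∷ R)) (sign² k) ⟨
  sign k * sign k * det (R k ∷ R)
    ≡⟨ *-assoc (sign k) (sign k) (det (R k ∷ R)) ⟩
  sign k * (sign k * det (R k ∷ R))
    ≡⟨ cong (sign k *_) (det-∷-scale (sign k) (R k) (toFront k R) R λ j →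
         trans
           (det-cong (minor (R k ∷ toFront k R) zero j) (toFront k (minor (R k ∷ R) zero j))
             λ { zero b → refl ; (suc a) b → refl })
           (det-toFront k (minor (R k ∷ R) zero j))) ⟨
  sign k * det (R k ∷ toFront k R)
    ≡⟨ cong (sign k *_) (det-row₀≡row₁ (R k ∷ toFront k R) (λ j → refl)) ⟩
  sign k * 0ℤ
    ≡⟨ *-zeroʳ (sign k) ⟩
  0ℤ ∎

det-∷-linear : ∀ a b (v w : Vector ℤ (ℕ.suc m)) (R : Matrix m (ℕ.suc m)) →
  det ((λ j → a * v j + b * w j) ∷ R) ≡ a * det (v ∷ R) + b * det (w ∷ R)
det-∷-linear a b v w R = begin
  sum (λ j → sign j * (a * v j + b * w j) * d j)
    ≡⟨ sum-cong-≗ (λ j → distrib (sign j) a (v j) b (w j) (d j)) ⟩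
  sum (λ j → a * (sign j * v j * d j) + b * (sign j * w j * d j))
    ≡⟨ ∑-distrib-+ (λ j → a * (sign j * v j * d j)) (λ j → b * (sign j * w j * d j)) ⟩
  sum (λ j → a * (sign j * v j * d j)) + sum (λ j → b * (sign j * w j * d j))
    ≡⟨ cong₂ _+_ (*-distribˡ-sum a (λ j → sign j * v j * d j)) (*-distribˡ-sum b (λ j → sign j * w j * d j)) ⟨
  a * det (v ∷ R) + b * det (w ∷ R) ∎
  where
  d : Fin _ → ℤ
  d j = det (minor (v ∷ R) zero j)

  distrib : ∀ s a x b y d → s * (a * x + b * y) * d ≡ a * (s * x * d) + b * (s * y * d)
  distrib = solve-∀

-- `S` is kept apart from `R` so that induction can drop rows from the combination while the lower
-- rows stay fixed. This also allows combining only some of the rows of `R`.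
det-∷-combination : ∀ {p} (u : Vector ℤ p) (S : Matrix p (ℕ.suc m)) (R : Matrix m (ℕ.suc m)) →
  (∀ k → det (S k ∷ R) ≡ 0ℤ) → det ((λ j → sum λ k → u k * S k j) ∷ R) ≡ 0ℤ
det-∷-combination {p = ℕ.zero} u S R eq = begin
  det ((λ j → 0ℤ) ∷ R)
    ≡⟨ det-cong ((λ j → 0ℤ) ∷ R) ((λ j → 0ℤ * 0ℤ + 0ℤ * 0ℤ) ∷ R) (λ { zero b → refl ; (suc a) b → refl }) ⟩
  det ((λ j → 0ℤ * 0ℤ + 0ℤ * 0ℤ) ∷ R)
    ≡⟨ det-∷-linear 0ℤ 0ℤ (λ j → 0ℤ) (λ j → 0ℤ) R ⟩
  0ℤ ∎
det-∷-combination {p = ℕ.suc p} u S R eq = begin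
  det ((λ j → u zero * S zero j + rest j) ∷ R)
    ≡⟨ det-cong ((λ j → u zero * S zero j + rest j) ∷ R) ((λ j → u zero * S zero j + 1ℤ * rest j) ∷ R)
         (λ { zero b → cong (_+_ (u zero * S zero b)) (sym (*-identityˡ (rest b))) ; (suc a) b → refl }) ⟩
  det ((λ j → u zero * S zero j + 1ℤ * rest j) ∷ R)
    ≡⟨ det-∷-linear (u zero) 1ℤ (S zero) rest R ⟩
  u zero * det (S zero ∷ R) + 1ℤ * det (rest ∷ R)
    ≡⟨ cong₂ (λ x y → u zero * x + 1ℤ * y) (eq zero) (det-∷-combination (tail u) (tail S) R λ k → eq (suc k)) ⟩
  u zero * 0ℤ + 1ℤ * 0ℤ
    ≡⟨ cong (_+ 0ℤ) (*-zeroʳ (u zero)) ⟩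
  0ℤ ∎
  where
  rest : Vector ℤ _
  rest j = sum λ k → u (suc k) * S (suc k) j

-- Order on the integers, sums, dot products and bilinear forms.

0<*0< : ∀ {a b} → 0ℤ < a → 0ℤ < b → 0ℤ < a * b
0<*0< {a} {b} 0<a 0<b = subst (_< a * b) (*-zeroʳ a) (*-monoˡ-<-pos a {{positive 0<a}} 0<b)

0≤*0≤ : ∀ {a b} → 0ℤ ≤ a → 0ℤ ≤ b → 0ℤ ≤ a * b
0≤*0≤ {a} {b} 0≤a 0≤b = subst (_≤ a * b) (*-zeroʳ a) (*-monoˡ-≤-nonNeg a {{nonNegative 0≤a}} 0≤b)

0<-cancel : ∀ {a b} → 0ℤ < a → 0ℤ < a * b → 0ℤ < b
0<-cancel {a} {b} 0<a 0<ab =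
  *-cancelˡ-<-nonNeg a {{nonNegative (<⇒≤ 0<a)}} (subst (_< a * b) (sym (*-zeroʳ a)) 0<ab)

0≤-cancel : ∀ {a b} → 0ℤ < a → 0ℤ ≤ a * b → 0ℤ ≤ b
0≤-cancel {a} {b} 0<a 0≤ab =
  *-cancelˡ-≤-pos 0ℤ b a {{positive 0<a}} (subst (_≤ a * b) (sym (*-zeroʳ a)) 0≤ab)

0≤square : ∀ a → 0ℤ ≤ a * a
0≤square (+ n)    = 0≤*0≤ {+ n} {+ n} (+≤+ ℕ.z≤n) (+≤+ ℕ.z≤n)
0≤square -[1+ n ] = +≤+ ℕ.z≤n

0<square : ∀ {a} → a ≢ 0ℤ → 0ℤ < a * a
0<square {+ ℕ.zero}  a≢0 with () ← a≢0 refl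
0<square {+[1+ n ]}  a≢0 = +<+ (ℕ.s≤s ℕ.z≤n)
0<square { -[1+ n ]} a≢0 = +<+ (ℕ.s≤s ℕ.z≤n)

sum-zero : {f : Vector ℤ m} → (∀ i → f i ≡ 0ℤ) → sum f ≡ 0ℤ
sum-zero {ℕ.zero}  f≡0 = refl
sum-zero {ℕ.suc m} f≡0 = cong₂ _+_ (f≡0 zero) (sum-zero λ i → f≡0 (suc i))

sum-linear : ∀ a b (f g : Vector ℤ m) →
  sum (λ i → a * f i + b * g i) ≡ a * sum f + b * sum g
sum-linear a b f g = trans
  (∑-distrib-+ (λ i → a * f i) (λ i → b * g i))
  (sym (cong₂ _+_ (*-distribˡ-sum a f) (*-distribˡ-sum b g)))

infix 8 _·_

_·_ : Vector ℤ m → Vector ℤ m → ℤ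
u · v = sum λ i → u i * v i

·-comm : (u v : Vector ℤ m) → u · v ≡ v · u
·-comm u v = sum-cong-≗ λ i → *-comm (u i) (v i)

linear : ℤ → ℤ → Vector ℤ m → Vector ℤ m → Vector ℤ m
linear a b u v i = a * u i + b * v i

·-linearˡ : ∀ a b (u v w : Vector ℤ m) → linear a b u v · w ≡ a * u · w + b * v · w
·-linearˡ a b u v w = trans
  (sum-cong-≗ λ i → distrib a (u i) b (v i) (w i))
  (sum-linear a b (λ i → u i * w i) (λ i → v i * w i))
  where
  distrib : ∀ a x b y z → (a * x + b * y) * z ≡ a * (x * z) + b * (y * z)
  distrib = solve-∀

·-linearʳ : ∀ a b (u v w : Vector ℤ m) → w · linear a b u v ≡ a * w · u + b * w · v
·-linearʳ a b u v w = trans (·-comm w (linear a b u v)) (trans (·-linearˡ a b u v w)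
  (cong₂ (λ x y → a * x + b * y) (·-comm u w) (·-comm v w)))

form : SqMatrix m → Vector ℤ m → Vector ℤ m → ℤ
form C x y = x · (λ i → C i · y)

quadraticForm≡form : (C : SqMatrix m) (x : Vector ℤ m) → quadraticForm C x ≡ form C x x
quadraticForm≡form C x = sum-cong-≗ λ i → trans
  (sum-cong-≗ λ j → *-assoc (x i) (C i j) (x j))
  (sym (*-distribˡ-sum (x i) λ j → C i j * x j))

form-congˡ : {A B : SqMatrix m} → A ≋ B → ∀ x y → form A x y ≡ form B x y
form-congˡ A≋B x y = sum-cong-≗ λ i → cong (x i *_) (sum-cong-≗ λ j → cong (_* y j) (A≋B i j))

form-sym : {C : SqMatrix m} → Symmetric C → ∀ x y → form C x y ≡ form C y x
form-sym {C = C} C-sym x y = begin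
  sum (λ i → x i * C i · y)
    ≡⟨ sum-cong-≗ (λ i → *-distribˡ-sum (x i) λ j → C i j * y j) ⟩
  sum (λ i → sum λ j → x i * (C i j * y j))
    ≡⟨ ∑-comm (λ i j → x i * (C i j * y j)) ⟩
  sum (λ j → sum λ i → x i * (C i j * y j))
    ≡⟨ sum-cong-≗ (λ j → sum-cong-≗ λ i → trans (cong (λ c → x i * (c * y j)) (C-sym i j)) (swap (x i) (C j i) (y j))) ⟩
  sum (λ j → sum λ i → y j * (C j i * x i))
    ≡⟨ sum-cong-≗ (λ j → *-distribˡ-sum (y j) λ i → C j i * x i) ⟨
  sum (λ j → y j * C j · x) ∎
  where
  swap : ∀ a c b → a * (c * b) ≡ b * (c * a)
  swap = solve-∀

form-linear² : {C : SqMatrix m} → Symmetric C → ∀ a b x y →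
  form C (linear a b x y) (linear a b x y) ≡
  a * a * form C x x + (+ 2 * a * b) * form C x y + b * b * form C y y
form-linear² {C = C} C-sym a b x y = begin
  linear a b x y · (λ i → C i · linear a b x y)
    ≡⟨ sum-cong-≗ (λ i → cong (linear a b x y i *_) (·-linearʳ a b x y (C i))) ⟩
  linear a b x y · linear a b (λ i → C i · x) (λ i → C i · y)
    ≡⟨ ·-linearˡ a b x y (linear a b (λ i → C i · x) (λ i → C i · y)) ⟩
  a * x · linear a b (λ i → C i · x) (λ i → C i · y) + b * y · linear a b (λ i → C i · x) (λ i → C i · y)
    ≡⟨ cong₂ (λ s t → a * s + b * t) (·-linearʳ a b _ _ x) (·-linearʳ a b _ _ y) ⟩
  a * (a * form C x x + b * form C x y) + b * (a * form C y x + b * form C y y)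
    ≡⟨ cong (λ s → a * (a * form C x x + b * form C x y) + b * (a * s + b * form C y y)) (form-sym C-sym y x) ⟩
  a * (a * form C x x + b * form C x y) + b * (a * form C x y + b * form C y y)
    ≡⟨ collect a b (form C x x) (form C x y) (form C y y) ⟩
  a * a * form C x x + (+ 2 * a * b) * form C x y + b * b * form C y y ∎
  where
  collect : ∀ a b p q r → a * (a * p + b * q) + b * (a * q + b * r) ≡ a * a * p + (+ 2 * a * b) * q + b * b * r
  collect = solve-∀

-- Bordered matrices, Schur complements and positivity.

bordered : ℤ → Vector ℤ m → Vector ℤ m → SqMatrix m → SqMatrix (ℕ.suc m)
bordered c v w D = (c ∷ v) ∷ λ i → w i ∷ D i

corner : SqMatrix (ℕ.suc m) → ℤ
corner C = C zero zero

topRow : SqMatrix (ℕ.suc m) → Vector ℤ m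
topRow C j = C zero (suc j)

inner : SqMatrix (ℕ.suc m) → SqMatrix m
inner C = minor C zero zero

bordered-η : {C : SqMatrix (ℕ.suc m)} → Symmetric C → C ≋ bordered (corner C) (topRow C) (topRow C) (inner C)
bordered-η C-sym zero    zero    = refl
bordered-η C-sym zero    (suc j) = refl
bordered-η C-sym (suc i) zero    = C-sym (suc i) zero
bordered-η C-sym (suc i) (suc j) = refl

bordered-sym : ∀ {c} {v : Vector ℤ m} {D} → Symmetric D → Symmetric (bordered c v v D)
bordered-sym D-sym zero    zero    = refl
bordered-sym D-sym zero    (suc j) = refl
bordered-sym D-sym (suc i) zero    = refl
bordered-sym D-sym (suc i) (suc j) = D-sym i j

form-bordered : ∀ c (v : Vector ℤ m) (D : SqMatrix m) z →
  form (bordered c v v D) z z ≡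
  c * (z zero * z zero) + (+ 2 * z zero) * v · tail z + form D (tail z) (tail z)
form-bordered c v D z = begin
  s * (c * s + v · x) + sum (λ i → x i * (v i * s + D i · x))
    ≡⟨ cong (_+_ (s * (c * s + v · x))) (sum-cong-≗ λ i → distrib (x i) (v i) s (D i · x)) ⟩
  s * (c * s + v · x) + sum (λ i → s * (v i * x i) + 1ℤ * (x i * D i · x))
    ≡⟨ cong (_+_ (s * (c * s + v · x))) (sum-linear s 1ℤ (λ i → v i * x i) (λ i → x i * D i · x)) ⟩
  s * (c * s + v · x) + (s * v · x + 1ℤ * form D x x)
    ≡⟨ collect c s (v · x) (form D x x) ⟩
  c * (s * s) + (+ 2 * s) * v · x + form D x x ∎
  where
  s : ℤ
  s = z zero
  x : Vector ℤ _
  x = tail z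

  distrib : ∀ x v s d → x * (v * s + d) ≡ s * (v * x) + 1ℤ * (x * d)
  distrib = solve-∀

  collect : ∀ c s p f → s * (c * s + p) + (s * p + 1ℤ * f) ≡ c * (s * s) + (+ 2 * s) * p + f
  collect = solve-∀

det-firstRow-e₀ : ∀ x (v : Vector ℤ m) (R : Matrix m (ℕ.suc m)) → (∀ j → v j ≡ 0ℤ) →
  det ((x ∷ v) ∷ R) ≡ x * det (λ i → tail (R i))
det-firstRow-e₀ {m} x v R v≡0 = begin
  1ℤ * x * d + sum (λ j → sign (suc j) * v j * e j)
    ≡⟨ cong (_+_ (1ℤ * x * d)) (sum-zero {f = λ j → sign (suc j) * v j * e j}
         λ j → trans (cong (λ c → sign (suc j) * c * e j) (v≡0 j)) (vanish (sign (suc j)) (e j))) ⟩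
  1ℤ * x * d + 0ℤ
    ≡⟨ unit x d ⟩
  x * d ∎
  where
  d : ℤ
  d = det λ i → tail (R i)

  e : Fin m → ℤ
  e j = det (minor ((x ∷ v) ∷ R) zero (suc j))

  vanish : ∀ s e → s * 0ℤ * e ≡ 0ℤ
  vanish = solve-∀

  unit : ∀ x d → 1ℤ * x * d + 0ℤ ≡ x * d
  unit = solve-∀

-- Subtract the combination u of the lower rows from d times the first row.
det-bordered : ∀ c (v w : Vector ℤ m) (D : SqMatrix m) d u →
  (∀ j → (sum λ k → u k * D k j) ≡ d * v j) →
  d * det (bordered c v w D) ≡ (d * c - u · w) * det D
det-bordered c v w D d u uD≡dv = begin
  d * det (bordered c v w D)
    ≡⟨ pad (d * det (bordered c v w D)) ⟩
  d * det (bordered c v w D) + -1ℤ * 0ℤ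
    ≡⟨ cong (λ e → d * det (bordered c v w D) + -1ℤ * e) (det-∷-combination u R R (det-row₀≡row R)) ⟨
  d * det (bordered c v w D) + -1ℤ * det ((λ j → sum λ k → u k * R k j) ∷ R)
    ≡⟨ det-∷-linear d -1ℤ (c ∷ v) (λ j → sum λ k → u k * R k j) R ⟨
  det ((λ j → d * (c ∷ v) j + -1ℤ * sum λ k → u k * R k j) ∷ R)
    ≡⟨ det-cong ((λ j → d * (c ∷ v) j + -1ℤ * sum λ k → u k * R k j) ∷ R)
         (((d * c - u · w) ∷ λ j → 0ℤ) ∷ R)
         (λ { zero zero    → minus (d * c) (u · w)
            ; zero (suc j) → trans (cong (λ t → d * v j + -1ℤ * t) (uD≡dv j)) (cancel (d * v j))
            ; (suc a) b    → refl }) ⟩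
  det (((d * c - u · w) ∷ λ j → 0ℤ) ∷ R)
    ≡⟨ det-firstRow-e₀ (d * c - u · w) (λ j → 0ℤ) R (λ j → refl) ⟩
  (d * c - u · w) * det D ∎
  where
  R : Matrix _ _
  R i = w i ∷ D i

  pad : ∀ x → x ≡ x + -1ℤ * 0ℤ
  pad = solve-∀

  minus : ∀ x y → x + -1ℤ * y ≡ x - y
  minus = solve-∀

  cancel : ∀ x → x + -1ℤ * x ≡ 0ℤ
  cancel = solve-∀

PositiveDefinite-cong : {A B : SqMatrix m} → A ≋ B → PositiveDefinite A → PositiveDefinite B
PositiveDefinite-cong {A = A} {B} A≋B A-pd x x≢0 = subst (0ℤ <_)
  (trans (quadraticForm≡form A x) (trans (form-congˡ A≋B x x) (sym (quadraticForm≡form B x)))) (A-pd x x≢0)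

0<form : (C : SqMatrix m) → PositiveDefinite C → ∀ x → ¬ (∀ i → x i ≡ 0ℤ) → 0ℤ < form C x x
0<form C C-pd x x≢0 = subst (0ℤ <_) (quadraticForm≡form C x) (C-pd x x≢0)

0≤form : (C : SqMatrix m) → PositiveDefinite C → ∀ x → 0ℤ ≤ form C x x
0≤form C C-pd x with all? (λ i → x i ≟ 0ℤ)
... | yes x≡0 = ≤-reflexive (sym (sum-zero λ i → trans (cong (_* C i · x) (x≡0 i)) (*-zeroˡ (C i · x))))
... | no  x≢0 = <⇒≤ (0<form C C-pd x x≢0)

form-∷0 : ∀ c v (D : SqMatrix m) z → z zero ≡ 0ℤ →
  form (bordered c v v D) z z ≡ form D (tail z) (tail z)
form-∷0 c v D z s≡0 = begin
  form (bordered c v v D) z z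
    ≡⟨ form-bordered c v D z ⟩
  c * (z zero * z zero) + (+ 2 * z zero) * v · tail z + form D (tail z) (tail z)
    ≡⟨ cong (λ s → c * (s * s) + (+ 2 * s) * v · tail z + form D (tail z) (tail z)) s≡0 ⟩
  c * (0ℤ * 0ℤ) + (+ 2 * 0ℤ) * v · tail z + form D (tail z) (tail z)
    ≡⟨ vanish c (v · tail z) (form D (tail z) (tail z)) ⟩
  form D (tail z) (tail z) ∎
  where
  vanish : ∀ c p f → c * (0ℤ * 0ℤ) + + 2 * 0ℤ * p + f ≡ f
  vanish = solve-∀

inner-PositiveDefinite : ∀ {c} {v : Vector ℤ m} {D} → PositiveDefinite (bordered c v v D) → PositiveDefinite D
inner-PositiveDefinite {c = c} {v} {D} B-pd x x≢0 = subst (0ℤ <_)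
  (trans (form-∷0 c v D (0ℤ ∷ x) refl) (sym (quadraticForm≡form D x)))
  (0<form (bordered c v v D) B-pd (0ℤ ∷ x) λ z≡0 → x≢0 λ i → z≡0 (suc i))

form-solution : ∀ (D : SqMatrix m) d u v → (∀ i → D i · u ≡ d * v i) → ∀ x → form D x u ≡ d * x · v
form-solution D d u v Du≡dv x = begin
  sum (λ i → x i * D i · u)   ≡⟨ sum-cong-≗ (λ i → trans (cong (x i *_) (Du≡dv i)) (swap (x i) d (v i))) ⟩
  sum (λ i → d * (x i * v i)) ≡⟨ *-distribˡ-sum d (λ i → x i * v i) ⟨
  d * x · v                   ∎
  where
  swap : ∀ x d v → x * (d * v) ≡ d * (x * v)
  swap = solve-∀

-- With D⁻¹v = u / d and z = (s, x), this is d² times the identity c s² + 2s vᵀx + xᵀDx = s² (c -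
-- vᵀD⁻¹v) + (x + s D⁻¹v)ᵀ D (x + s D⁻¹v).
complete-square : ∀ c v {D : SqMatrix m} → Symmetric D → ∀ d u → (∀ i → D i · u ≡ d * v i) → ∀ z →
  d * d * form (bordered c v v D) z z ≡
  d * (z zero * z zero) * (d * c - u · v) +
  form D (linear d (z zero) (tail z) u) (linear d (z zero) (tail z) u)
complete-square c v {D} D-sym d u Du≡dv z = begin
  d * d * form (bordered c v v D) z z
    ≡⟨ cong (d * d *_) (form-bordered c v D z) ⟩
  d * d * (c * (s * s) + (+ 2 * s) * v · x + form D x x)
    ≡⟨ cong (λ p → d * d * (c * (s * s) + (+ 2 * s) * p + form D x x)) (·-comm v x) ⟩
  d * d * (c * (s * s) + (+ 2 * s) * x · v + form D x x)
    ≡⟨ identity d c s (x · v) (u · v) (form D x x) ⟩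
  d * (s * s) * (d * c - u · v) + (d * d * form D x x + (+ 2 * d * s) * (d * x · v) + s * s * (d * u · v))
    ≡⟨ cong₂ (λ p q → d * (s * s) * (d * c - u · v) + (d * d * form D x x + (+ 2 * d * s) * p + s * s * q))
         (form-solution D d u v Du≡dv x) (form-solution D d u v Du≡dv u) ⟨
  d * (s * s) * (d * c - u · v) + (d * d * form D x x + (+ 2 * d * s) * form D x u + s * s * form D u u)
    ≡⟨ cong (_+_ (d * (s * s) * (d * c - u · v))) (form-linear² D-sym d s x u) ⟨
  d * (s * s) * (d * c - u · v) + form D (linear d s x u) (linear d s x u) ∎
  where
  s : ℤ
  s = z zero
  x : Vector ℤ _
  x = tail z

  identity : ∀ d c s p r f → d * d * (c * (s * s) + (+ 2 * s) * p + f) ≡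
    d * (s * s) * (d * c - r) + (d * d * f + (+ 2 * d * s) * (d * p) + s * s * (d * r))
  identity = solve-∀

-- The form is evaluated at (d, -u), where the completed square vanishes and only the Schur
-- complement, scaled by `d`, is left.
schur-positive : ∀ c v {D : SqMatrix m} → Symmetric D → PositiveDefinite (bordered c v v D) →
  ∀ d u → 0ℤ < d → (∀ i → D i · u ≡ d * v i) → 0ℤ < d * c - u · v
schur-positive c v {D} D-sym B-pd d u 0<d Du≡dv =
  0<-cancel (0<*0< 0<d (0<*0< 0<d 0<d)) (subst (0ℤ <_)
    (begin
      d * d * form (bordered c v v D) z z
        ≡⟨ complete-square c v D-sym d u Du≡dv z ⟩
      d * (d * d) * (d * c - u · v) + form D (linear d d (tail z) u) (linear d d (tail z) u)
        ≡⟨ cong (_+_ (d * (d * d) * (d * c - u · v)))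
             (sum-zero λ i → trans (cong (_* D i · linear d d (tail z) u) (cancel d (u i)))
               (*-zeroˡ (D i · linear d d (tail z) u))) ⟩
      d * (d * d) * (d * c - u · v) + 0ℤ
        ≡⟨ +-identityʳ _ ⟩
      d * (d * d) * (d * c - u · v) ∎)
    (0<*0< (0<*0< 0<d 0<d) (0<form (bordered c v v D) B-pd z λ z≡0 → <-irrefl (sym (z≡0 zero)) 0<d)))
  where
  z : Vector ℤ _
  z = d ∷ λ i → - u i

  cancel : ∀ d u → d * - u + d * u ≡ 0ℤ
  cancel = solve-∀

-- Block elimination stands in for Cramer's rule, so that no adjugate is needed.
solve : (C : SqMatrix m) → Symmetric C → PositiveDefinite C → (v : Vector ℤ m) →
  ∃[ d ] ∃[ u ] 0ℤ < d × (∀ i → C i · u ≡ d * v i)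
solve {ℕ.zero}  C C-sym C-pd v = 1ℤ , (λ ()) , +<+ (ℕ.s≤s ℕ.z≤n) , λ ()
solve {ℕ.suc m} C C-sym C-pd v
  with D-sym ← (λ i j → C-sym (suc i) (suc j))
  with B-pd ← PositiveDefinite-cong (bordered-η C-sym) C-pd
  with d , u , 0<d , Du≡dw ← solve (inner C) D-sym (inner-PositiveDefinite B-pd) (topRow C)
  with e , y , 0<e , Dy≡ev ← solve (inner C) D-sym (inner-PositiveDefinite B-pd) (tail v)
  -- Over ℚ the first unknown is z₀ = (B / e) / (Δ / d), and the others are y / e - z₀ u / d. The
  -- multiplier `Δ * e` clears all denominators.
  = Δ * e , B * d ∷ linear Δ (- B) y u , 0<*0< (schur-positive c w D-sym B-pd d u 0<d Du≡dw) 0<e ,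
    λ { zero → begin
          c * (B * d) + w · linear Δ (- B) y u
            ≡⟨ cong (_+_ (c * (B * d))) (·-linearʳ Δ (- B) y u w) ⟩
          c * (B * d) + (Δ * w · y + - B * w · u)
            ≡⟨ cong (λ p → c * (B * d) + (Δ * w · y + - B * p)) (·-comm w u) ⟩
          c * (B * d) + (Δ * w · y + - B * u · w)
            ≡⟨ first d c (u · w) e (v zero) (w · y) ⟩
          Δ * e * v zero ∎
      ; (suc i) → begin
          C (suc i) zero * (B * d) + inner C i · linear Δ (- B) y u
            ≡⟨ cong₂ (λ p q → p * (B * d) + q) (C-sym (suc i) zero) (·-linearʳ Δ (- B) y u (inner C i)) ⟩
          w i * (B * d) + (Δ * inner C i · y + - B * inner C i · u)
            ≡⟨ cong₂ (λ p q → w i * (B * d) + (Δ * p + - B * q)) (Dy≡ev i) (Du≡dw i) ⟩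
          w i * (B * d) + (Δ * (e * v (suc i)) + - B * (d * w i))
            ≡⟨ others Δ B d e (w i) (v (suc i)) ⟩
          Δ * e * v (suc i) ∎ }
  where
  c : ℤ
  c = corner C
  w : Vector ℤ m
  w = topRow C
  Δ B : ℤ
  Δ = d * c - u · w
  B = e * v zero - w · y

  first : ∀ d c p e γ r →
    c * ((e * γ - r) * d) + ((d * c - p) * r + - (e * γ - r) * p) ≡ (d * c - p) * e * γ
  first = solve-∀

  others : ∀ Δ B d e w v → w * (B * d) + (Δ * (e * v) + - B * (d * w)) ≡ Δ * e * v
  others = solve-∀

row-solution : {D : SqMatrix m} → Symmetric D → ∀ d (u v : Vector ℤ m) → (∀ i → D i · u ≡ d * v i) →
  ∀ j → (sum λ k → u k * D k j) ≡ d * v j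
row-solution {D = D} D-sym d u v Du≡dv j = trans
  (sum-cong-≗ λ k → trans (*-comm (u k) (D k j)) (cong (_* u k) (D-sym k j))) (Du≡dv j)

-- By induction: up to the positive factor `d`, the determinant is the Schur complement of the first
-- index times the determinant of `inner C`.
0<det : (C : SqMatrix m) → Symmetric C → PositiveDefinite C → 0ℤ < det C
0<det {ℕ.zero}  C C-sym C-pd = +<+ (ℕ.s≤s ℕ.z≤n)
0<det {ℕ.suc m} C C-sym C-pd
  with D-sym ← (λ i j → C-sym (suc i) (suc j))
  with B-pd ← PositiveDefinite-cong (bordered-η C-sym) C-pd
  with d , u , 0<d , Du≡dw ← solve (inner C) D-sym (inner-PositiveDefinite B-pd) (topRow C)
  = 0<-cancel 0<d (subst (0ℤ <_)
      (sym (trans (cong (d *_) (det-cong C (bordered (corner C) (topRow C) (topRow C) (inner C)) (bordered-η C-sym)))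
        (det-bordered (corner C) (topRow C) (topRow C) (inner C) d u (row-solution D-sym d u (topRow C) Du≡dw))))
      (0<*0< (schur-positive (corner C) (topRow C) D-sym B-pd d u 0<d Du≡dw)
        (0<det (inner C) D-sym (inner-PositiveDefinite B-pd))))

-- Since det D > 0, the sign of the bordered determinant is that of the Schur complement, so both
-- terms of the completed square are nonnegative. It is applied with corner 3, where definiteness
-- may fail.
bordered-semidefinite : ∀ c v {D : SqMatrix m} → Symmetric D → PositiveDefinite D →
  0ℤ ≤ det (bordered c v v D) → ∀ z → 0ℤ ≤ form (bordered c v v D) z z
bordered-semidefinite c v {D} D-sym D-pd 0≤det z
  with d , u , 0<d , Du≡dv ← solve D D-sym D-pd v
  = 0≤-cancel (0<*0< 0<d 0<d) (subst (0ℤ ≤_) (sym (complete-square c v D-sym d u Du≡dv z))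
      (+-mono-≤
        (0≤*0≤ (0≤*0≤ (<⇒≤ 0<d) (0≤square (z zero))) (0≤-cancel (0<det D D-sym D-pd) (subst (0ℤ ≤_)
          (trans (det-bordered c v v D d u (row-solution D-sym d u v Du≡dv)) (*-comm (d * c - u · v) (det D)))
          (0≤*0≤ (<⇒≤ 0<d) 0≤det))))
        (0≤form D D-pd (linear d (z zero) (tail z) u))))

-- Changing a corner entry and duplicating an index.

det-firstRow-e₀e₁ : ∀ x y (R : Matrix (ℕ.suc m) (2 ℕ.+ m)) →
  det ((x ∷ y ∷ λ j → 0ℤ) ∷ R) ≡
  x * det (λ i → tail (R i)) - y * det (λ i j → R i (punchIn (suc zero) j))
det-firstRow-e₀e₁ {m} x y R = begin
  1ℤ * x * d + (-1ℤ * y * e + sum λ j → sign (suc (suc j)) * 0ℤ * f j)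
    ≡⟨ cong (λ s → 1ℤ * x * d + (-1ℤ * y * e + s)) (sum-zero {f = λ j → sign (suc (suc j)) * 0ℤ * f j}
         λ j → vanish (sign (suc (suc j))) (f j)) ⟩
  1ℤ * x * d + (-1ℤ * y * e + 0ℤ)
    ≡⟨ unit x d y e ⟩
  x * d - y * e ∎
  where
  d e : ℤ
  d = det λ i → tail (R i)
  e = det λ i j → R i (punchIn (suc zero) j)

  f : Fin m → ℤ
  f j = det (minor ((x ∷ y ∷ λ j → 0ℤ) ∷ R) zero (suc (suc j)))

  vanish : ∀ s e → s * 0ℤ * e ≡ 0ℤ
  vanish = solve-∀

  unit : ∀ x d y e → 1ℤ * x * d + (-1ℤ * y * e + 0ℤ) ≡ x * d - y * e
  unit = solve-∀

det-corner : ∀ c c′ (v w : Vector ℤ m) D →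
  det (bordered c v w D) ≡ det (bordered c′ v w D) + (c - c′) * det D
det-corner c c′ v w D = begin
  det (bordered c v w D)
    ≡⟨ det-cong (bordered c v w D) (linear 1ℤ (c - c′) (c′ ∷ v) (1ℤ ∷ λ j → 0ℤ) ∷ R)
         (λ { zero zero → first c c′ ; zero (suc j) → others (c - c′) (v j) ; (suc a) b → refl }) ⟩
  det (linear 1ℤ (c - c′) (c′ ∷ v) (1ℤ ∷ λ j → 0ℤ) ∷ R)
    ≡⟨ det-∷-linear 1ℤ (c - c′) (c′ ∷ v) (1ℤ ∷ λ j → 0ℤ) R ⟩
  1ℤ * det (bordered c′ v w D) + (c - c′) * det ((1ℤ ∷ λ j → 0ℤ) ∷ R)
    ≡⟨ cong₂ (λ x y → x + (c - c′) * y) (*-identityˡ (det (bordered c′ v w D)))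
         (trans (det-firstRow-e₀ 1ℤ (λ j → 0ℤ) R (λ j → refl)) (*-identityˡ (det D))) ⟩
  det (bordered c′ v w D) + (c - c′) * det D ∎
  where
  R : Matrix _ _
  R i = w i ∷ D i

  first : ∀ c c′ → c ≡ 1ℤ * c′ + (c - c′) * 1ℤ
  first = solve-∀

  others : ∀ a x → x ≡ 1ℤ * x + a * 0ℤ
  others = solve-∀

-- C̃ for the index 0 instead of the last one.
det₃ : SqMatrix (ℕ.suc m) → ℤ
det₃ C = det (bordered (+ 3) (topRow C) (topRow C) (inner C))

det-det₃ : ∀ {n} {C : SqMatrix (ℕ.suc m)} → Symmetric C → C zero zero ≡ n →
  det C ≡ det₃ C + (n - + 3) * det (inner C)
det-det₃ {C = C} C-sym refl = trans
  (det-cong C (bordered (corner C) (topRow C) (topRow C) (inner C)) (bordered-η C-sym))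
  (det-corner (corner C) (+ 3) (topRow C) (topRow C) (inner C))

-- C with a second copy of its index 0 in front; the two copies are joined by the entry 3.
copy : ℤ → SqMatrix (ℕ.suc m) → SqMatrix (2 ℕ.+ m)
copy n C = bordered n (+ 3 ∷ topRow C) (+ 3 ∷ topRow C) C

-- Subtracting the second row from the first leaves (n - 3, 3 - n, 0, ..., 0), because the two
-- copies differ only in their own entries. The two minors that survive are `C` and `C` with corner
-- 3.
det-copy : ∀ {n} (C : SqMatrix (ℕ.suc m)) → Symmetric C → C zero zero ≡ n →
  det (copy n C) ≡ (n - + 3) * (det C + det₃ C)
det-copy {m} {n} C C-sym refl = begin
  det (copy n C)
    ≡⟨ pad (det (copy n C)) ⟩
  1ℤ * det (copy n C) + -1ℤ * 0ℤ
    ≡⟨ cong (λ e → 1ℤ * det (copy n C) + -1ℤ * e) (det-row₀≡row R zero) ⟨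
  1ℤ * det (copy n C) + -1ℤ * det (R zero ∷ R)
    ≡⟨ det-∷-linear 1ℤ -1ℤ (n ∷ + 3 ∷ topRow C) (R zero) R ⟨
  det (linear 1ℤ -1ℤ (n ∷ + 3 ∷ topRow C) (R zero) ∷ R)
    ≡⟨ det-cong (linear 1ℤ -1ℤ (n ∷ + 3 ∷ topRow C) (R zero) ∷ R) (((n - + 3) ∷ (+ 3 - n) ∷ λ j → 0ℤ) ∷ R)
         (λ { zero zero → minus n (+ 3) ; zero (suc zero) → minus (+ 3) n
            ; zero (suc (suc j)) → cancel (C zero (suc j)) ; (suc a) b → refl }) ⟩
  det (((n - + 3) ∷ (+ 3 - n) ∷ λ j → 0ℤ) ∷ R)
    ≡⟨ det-firstRow-e₀e₁ (n - + 3) (+ 3 - n) R ⟩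
  (n - + 3) * det C - (+ 3 - n) * det (λ i j → R i (punchIn (suc zero) j))
    ≡⟨ cong (λ d → (n - + 3) * det C - (+ 3 - n) * d)
         (det-cong (λ i j → R i (punchIn (suc zero) j)) (bordered (+ 3) (topRow C) (topRow C) (inner C))
           λ { zero zero → refl ; zero (suc j) → refl ; (suc i) zero → refl ; (suc i) (suc j) → refl }) ⟩
  (n - + 3) * det C - (+ 3 - n) * det₃ C
    ≡⟨ collect n (det C) (det₃ C) ⟩
  (n - + 3) * (det C + det₃ C) ∎
  where
  R : Matrix (ℕ.suc m) (2 ℕ.+ m)
  R i = (+ 3 ∷ topRow C) i ∷ C i

  pad : ∀ x → x ≡ 1ℤ * x + -1ℤ * 0ℤ
  pad = solve-∀

  minus : ∀ x y → 1ℤ * x + -1ℤ * y ≡ x - y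
  minus = solve-∀

  cancel : ∀ x → 1ℤ * x + -1ℤ * x ≡ 0ℤ
  cancel = solve-∀

  collect : ∀ n a b → (n - + 3) * a - (+ 3 - n) * b ≡ (n - + 3) * (a + b)
  collect = solve-∀

-- The copies share all outer entries, so outside the diagonal surplus n - 3 only s + t enters.
-- Positivity of the copy is thereby reduced to semidefiniteness of the matrix with corner 3.
form-copy : ∀ {n} (C : SqMatrix (ℕ.suc m)) → Symmetric C → C zero zero ≡ n → ∀ s t x →
  form (copy n C) (s ∷ t ∷ x) (s ∷ t ∷ x) ≡
  (n - + 3) * (s * s + t * t) +
  form (bordered (+ 3) (topRow C) (topRow C) (inner C)) ((s + t) ∷ x) ((s + t) ∷ x)
form-copy {n = n} C C-sym refl s t x = begin
  form (copy n C) (s ∷ t ∷ x) (s ∷ t ∷ x)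
    ≡⟨ form-bordered n (+ 3 ∷ topRow C) C (s ∷ t ∷ x) ⟩
  n * (s * s) + (+ 2 * s) * (+ 3 * t + topRow C · x) + form C (t ∷ x) (t ∷ x)
    ≡⟨ cong (_+_ (n * (s * s) + (+ 2 * s) * (+ 3 * t + topRow C · x)))
         (trans (form-congˡ (bordered-η C-sym) (t ∷ x) (t ∷ x)) (form-bordered n (topRow C) (inner C) (t ∷ x))) ⟩
  n * (s * s) + (+ 2 * s) * (+ 3 * t + topRow C · x) +
  (n * (t * t) + (+ 2 * t) * topRow C · x + form (inner C) x x)
    ≡⟨ identity n s t (topRow C · x) (form (inner C) x x) ⟩
  (n - + 3) * (s * s + t * t) +
  (+ 3 * ((s + t) * (s + t)) + (+ 2 * (s + t)) * topRow C · x + form (inner C) x x)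
    ≡⟨ cong (_+_ ((n - + 3) * (s * s + t * t))) (form-bordered (+ 3) (topRow C) (inner C) ((s + t) ∷ x)) ⟨
  (n - + 3) * (s * s + t * t) +
  form (bordered (+ 3) (topRow C) (topRow C) (inner C)) ((s + t) ∷ x) ((s + t) ∷ x) ∎
  where
  identity : ∀ n s t p f →
    n * (s * s) + (+ 2 * s) * (+ 3 * t + p) + (n * (t * t) + (+ 2 * t) * p + f) ≡
    (n - + 3) * (s * s + t * t) + (+ 3 * ((s + t) * (s + t)) + (+ 2 * (s + t)) * p + f)
  identity = solve-∀

-- Reindexing and shrinking matrices of the class.

reindex-PositiveDefinite : (π : Permutation p q) (C : SqMatrix q) → PositiveDefinite C →
  PositiveDefinite (reindex (π ⟨$⟩ʳ_) C)
reindex-PositiveDefinite π C C-pd x x≢0 = subst (0ℤ <_)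
  (begin
    (sum λ i → sum λ j → y i * C i j * y j)
      ≡⟨ sum-permute (λ i → sum λ j → y i * C i j * y j) π ⟩
    (sum λ i → sum λ j → y (f i) * C (f i) j * y j)
      ≡⟨ sum-cong-≗ (λ i → sum-permute (λ j → y (f i) * C (f i) j * y j) π) ⟩
    (sum λ i → sum λ j → y (f i) * C (f i) (f j) * y (f j))
      ≡⟨ sum-cong-≗ (λ i → sum-cong-≗ λ j → cong₂ (λ a b → a * C (f i) (f j) * b) (yf i) (yf j)) ⟩
    (sum λ i → sum λ j → x i * C (f i) (f j) * x j) ∎)
  (C-pd y λ y≡0 → x≢0 λ i → trans (sym (yf i)) (y≡0 (f i)))
  where
  f = π ⟨$⟩ʳ_

  y : Vector ℤ _
  y i = x (π ⟨$⟩ˡ i)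

  yf : ∀ i → y (f i) ≡ x i
  yf i = cong x (inverseˡ π)

reindex-ℭ : ∀ {n} (π : Permutation p q) (C : SqMatrix q) → ℭ n C → ℭ n (reindex (π ⟨$⟩ʳ_) C)
reindex-ℭ π C C∈ℭ = record
  { symmetric        = λ i j → symmetric (π ⟨$⟩ʳ i) (π ⟨$⟩ʳ j)
  ; positiveDefinite = reindex-PositiveDefinite π C positiveDefinite
  ; diagonal         = λ i → diagonal (π ⟨$⟩ʳ i)
  ; congruent        = λ i j → congruent (π ⟨$⟩ʳ i) (π ⟨$⟩ʳ j)
  }
  where open ℭ C∈ℭ

inner-ℭ : ∀ {n} (C : SqMatrix (ℕ.suc m)) → ℭ n C → ℭ n (inner C)
inner-ℭ C C∈ℭ = record
  { symmetric        = λ i j → symmetric (suc i) (suc j)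
  ; positiveDefinite = inner-PositiveDefinite (PositiveDefinite-cong (bordered-η symmetric) positiveDefinite)
  ; diagonal         = λ i → diagonal (suc i)
  ; congruent        = λ i j → congruent (suc i) (suc j)
  }
  where open ℭ C∈ℭ

-- The two polynomial contradictions with maximality.

-- Put T = 2hδ + 2γ - α - β and S = α + β - 2hδ, so that 2γ = T + S. Then 4 (αβ - γ²) = (α + β)² -
-- (α - β)² - 4γ² becomes 4δ (f - h (2α - hδ)) = -T² - 2TS - 4hδ (α - β) - (α - β)², which is
-- negative, while `copy≤f` makes the left side nonnegative.
copy-no-gain : ∀ h δ α β γ f → 0ℤ < h → 0ℤ < δ → δ * f ≡ α * β - γ * γ →
  0ℤ < + 2 * (h * δ) + + 2 * γ - α - β → + 2 * (h * δ) ≤ α + β → β ≤ α →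
  h * (α + (α - h * δ)) ≤ f → ⊥
copy-no-gain h δ α β γ f 0<h 0<δ δf 0<T 2hδ≤α+β β≤α copy≤f =
  <-irrefl refl (subst (0ℤ <_) (trans (cong total δf) (identity h δ α β γ))
    (+-mono-<-≤ (0<*0< 0<T 0<T)
    (+-mono-≤ (0≤*0≤ {+ 4} (+≤+ ℕ.z≤n) (i≤j⇒0≤j-i (*-monoˡ-≤-nonNeg δ {{nonNegative (<⇒≤ 0<δ)}} copy≤f)))
    (+-mono-≤ (0≤*0≤ {+ 2} (+≤+ ℕ.z≤n) (0≤*0≤ (<⇒≤ 0<T) (i≤j⇒0≤j-i 2hδ≤α+β)))
    (+-mono-≤ (0≤*0≤ {+ 4} (+≤+ ℕ.z≤n) (0≤*0≤ (<⇒≤ (0<*0< 0<h 0<δ)) (i≤j⇒0≤j-i β≤α)))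
    (0≤square (α - β)))))))
  where
  total : ℤ → ℤ
  total t =
    (+ 2 * (h * δ) + + 2 * γ - α - β) * (+ 2 * (h * δ) + + 2 * γ - α - β) +
    (+ 4 * (t - δ * (h * (α + (α - h * δ)))) +
    (+ 2 * ((+ 2 * (h * δ) + + 2 * γ - α - β) * (α + β - + 2 * (h * δ))) +
    (+ 4 * ((h * δ) * (α - β)) + (α - β) * (α - β))))

  identity : ∀ h δ α β γ →
    (+ 2 * (h * δ) + + 2 * γ - α - β) * (+ 2 * (h * δ) + + 2 * γ - α - β) +
    (+ 4 * (α * β - γ * γ - δ * (h * (α + (α - h * δ)))) +
    (+ 2 * ((+ 2 * (h * δ) + + 2 * γ - α - β) * (α + β - + 2 * (h * δ))) +
    (+ 4 * ((h * δ) * (α - β)) + (α - β) * (α - β)))) ≡ 0ℤ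
  identity = solve-∀

-- Here 4δf = (α + β)² - (α - β)² - 4γ² is at most (α + β)². As α + β is positive, squaring α + β <
-- 2hδ is allowed and gives f < h²δ.
sparse-no-gain : ∀ h δ α β γ f → 0ℤ < h → 0ℤ < δ → 0ℤ < α → 0ℤ < β → δ * f ≡ α * β - γ * γ →
  α + β < + 2 * (h * δ) → h * (h * δ) ≤ f → ⊥
sparse-no-gain h δ α β γ f 0<h 0<δ 0<α 0<β δf α+β<2hδ h²δ≤f =
  <-irrefl refl (subst (0ℤ <_) (trans (cong total δf) (identity h δ α β γ))
    (+-mono-<-≤ (0<*0< (0<j-i α+β<2hδ)
      (+-mono-< (+-mono-< 0<α 0<β) (0<*0< {+ 2} (+<+ (ℕ.s≤s ℕ.z≤n)) (0<*0< 0<h 0<δ))))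
    (+-mono-≤ (0≤*0≤ {+ 4} (+≤+ ℕ.z≤n) (i≤j⇒0≤j-i (*-monoˡ-≤-nonNeg δ {{nonNegative (<⇒≤ 0<δ)}} h²δ≤f)))
    (+-mono-≤ (0≤square (α - β)) (0≤square (γ + γ))))))
  where
  0<j-i : ∀ {i j} → i < j → 0ℤ < j - i
  0<j-i {i} {j} i<j = subst (_< j - i) (+-inverseʳ i) (+-monoˡ-< (- i) i<j)

  total : ℤ → ℤ
  total t = (+ 2 * (h * δ) - (α + β)) * (α + β + + 2 * (h * δ)) +
    (+ 4 * (t - δ * (h * (h * δ))) + ((α - β) * (α - β) + (γ + γ) * (γ + γ)))

  identity : ∀ h δ α β γ → (+ 2 * (h * δ) - (α + β)) * (α + β + + 2 * (h * δ)) +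
    (+ 4 * (α * β - γ * γ - δ * (h * (h * δ))) + ((α - β) * (α - β) + (γ + γ) * (γ + γ))) ≡ 0ℤ
  identity = solve-∀

-- A matrix with two borders, reduced to its 2 × 2 Schur complement.

module TwoBorders
  (a b c : ℤ) (x y : Vector ℤ m) (D : SqMatrix m) (D-sym : Symmetric D)
  (d : ℤ) (u : Vector ℤ m) (Du≡dx : ∀ i → D i · u ≡ d * x i)
  (e : ℤ) (w : Vector ℤ m) (Dw≡ey : ∀ i → D i · w ≡ e * y i)
  where

  δ α β γ : ℤ
  δ = det D
  α = det (bordered a x x D)
  β = det (bordered b y y D)
  γ = det (bordered c y x D)

  -- Entries of the Schur complement of `D`, cleared of denominators: `A` and `C` carry the factor
  -- `d`, `B` and `C′` the factor `e`. `C` and `C′` come from the same off-diagonal entry c -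
  -- xᵀD⁻¹y.
  A B C C′ : ℤ
  A = d * a - u · x
  B = e * b - w · y
  C = d * c - u · y
  C′ = e * c - w · x

  -- Symmetry of D⁻¹ in division-free form: both sides are the value of the form of `D` at `u` and
  -- `w`.
  cross : e * (u · y) ≡ d * (w · x)
  cross = begin
    e * (u · y)  ≡⟨ form-solution D e w y Dw≡ey u ⟨
    form D u w   ≡⟨ form-sym D-sym u w ⟩
    form D w u   ≡⟨ form-solution D d u x Du≡dx w ⟩
    d * (w · x)  ∎

  dα : d * α ≡ A * δ
  dα = det-bordered a x x D d u (row-solution D-sym d u x Du≡dx)

  eβ : e * β ≡ B * δ
  eβ = det-bordered b y y D e w (row-solution D-sym e w y Dw≡ey)

  eγ : e * γ ≡ C′ * δ
  eγ = det-bordered c y x D e w (row-solution D-sym e w y Dw≡ey)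

  eC : e * C ≡ d * C′
  eC = begin
    e * (d * c - u · y)       ≡⟨ distrib e d c (u · y) ⟩
    d * (e * c) - e * (u · y) ≡⟨ cong (λ t → d * (e * c) - t) cross ⟩
    d * (e * c) - d * (w · x) ≡⟨ undistrib d (e * c) (w · x) ⟩
    d * (e * c - w · x)       ∎
    where
    distrib : ∀ e d c p → e * (d * c - p) ≡ d * (e * c) - e * p
    distrib = solve-∀
    undistrib : ∀ d p q → d * p - d * q ≡ d * (p - q)
    undistrib = solve-∀

  Cδ : 0ℤ < e → C * δ ≡ d * γ
  Cδ 0<e = *-cancelˡ-≡ e (C * δ) (d * γ) {{>-nonZero 0<e}} (begin
    e * (C * δ)  ≡⟨ *-assoc e C δ ⟨
    e * C * δ    ≡⟨ cong (_* δ) eC ⟩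
    d * C′ * δ   ≡⟨ *-assoc d C′ δ ⟩
    d * (C′ * δ) ≡⟨ cong (d *_) eγ ⟨
    d * (e * γ)  ≡⟨ swap d e γ ⟩
    e * (d * γ)  ∎)
    where
    swap : ∀ d e g → d * (e * g) ≡ e * (d * g)
    swap = solve-∀

  E : SqMatrix (2 ℕ.+ m)
  E = bordered a (c ∷ x) (c ∷ x) (bordered b y y D)

  d-det : d * det E ≡ A * β - C * γ
  d-det = begin
    d * det E
      ≡⟨ pad (d * det E) ⟩
    d * det E + -1ℤ * 0ℤ
      -- Only the rows through `D` are subtracted, not the row of the second border, so the first
      -- row becomes (A, C, 0, ..., 0).
      ≡⟨ cong (λ t → d * det E + -1ℤ * t) (det-∷-combination u (tail R) R λ k → det-row₀≡row R (suc k)) ⟨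
    d * det E + -1ℤ * det ((λ j → sum λ k → u k * R (suc k) j) ∷ R)
      ≡⟨ det-∷-linear d -1ℤ (a ∷ c ∷ x) (λ j → sum λ k → u k * R (suc k) j) R ⟨
    det (linear d -1ℤ (a ∷ c ∷ x) (λ j → sum λ k → u k * R (suc k) j) ∷ R)
      ≡⟨ det-cong (linear d -1ℤ (a ∷ c ∷ x) (λ j → sum λ k → u k * R (suc k) j) ∷ R)
           ((A ∷ C ∷ λ j → 0ℤ) ∷ R)
           (λ { zero zero → minus (d * a) (u · x)
              ; zero (suc zero) → minus (d * c) (u · y)
              ; zero (suc (suc j)) → trans
                  (cong (λ t → d * x j + -1ℤ * t) (row-solution D-sym d u x Du≡dx j)) (cancel (d * x j))
              ; (suc i) j → refl }) ⟩
    det ((A ∷ C ∷ λ j → 0ℤ) ∷ R)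
      ≡⟨ det-firstRow-e₀e₁ A C R ⟩
    A * β - C * det (λ i j → R i (punchIn (suc zero) j))
      ≡⟨ cong (λ t → A * β - C * t) (det-cong (λ i j → R i (punchIn (suc zero) j)) (bordered c y x D)
           λ { zero zero → refl ; zero (suc j) → refl ; (suc i) zero → refl ; (suc i) (suc j) → refl }) ⟩
    A * β - C * γ ∎
    where
    R : Matrix (ℕ.suc m) (2 ℕ.+ m)
    R i = (c ∷ x) i ∷ bordered b y y D i

    pad : ∀ x → x ≡ x + -1ℤ * 0ℤ
    pad = solve-∀

    minus : ∀ x y → x + -1ℤ * y ≡ x - y
    minus = solve-∀

    cancel : ∀ x → x + -1ℤ * x ≡ 0ℤ
    cancel = solve-∀

  -- Multiplying `d-det` by δ turns A δ into d α and C δ into d γ; the factor `d` then cancels.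
  desnanot-jacobi : 0ℤ < d → 0ℤ < e → δ * det E ≡ α * β - γ * γ
  desnanot-jacobi 0<d 0<e = *-cancelˡ-≡ d (δ * det E) (α * β - γ * γ) {{>-nonZero 0<d}} (begin
    d * (δ * det E)               ≡⟨ swap d δ (det E) ⟩
    δ * (d * det E)               ≡⟨ cong (δ *_) d-det ⟩
    δ * (A * β - C * γ)           ≡⟨ distrib δ A β C γ ⟩
    A * δ * β - C * δ * γ         ≡⟨ cong₂ (λ s t → s * β - t * γ) (sym dα) (Cδ 0<e) ⟩
    d * α * β - d * γ * γ         ≡⟨ factor d α β γ ⟩
    d * (α * β - γ * γ)           ∎)
    where
    swap : ∀ d e g → d * (e * g) ≡ e * (d * g)
    swap = solve-∀
    distrib : ∀ δ A β C γ → δ * (A * β - C * γ) ≡ A * δ * β - C * δ * γ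
    distrib = solve-∀
    factor : ∀ d α β γ → d * α * β - d * γ * γ ≡ d * (α * β - γ * γ)
    factor = solve-∀

  -- (e d)² times (x - y)ᵀ D⁻¹ (x - y).
  gap : 0ℤ < e → δ * form D (linear e (- d) u w) (linear e (- d) u w) ≡
    (e * d) * ((e * d) * (δ * (a + b - + 2 * c) + + 2 * γ - α - β))
  gap 0<e = begin
    δ * form D (linear e (- d) u w) (linear e (- d) u w)
      ≡⟨ cong (δ *_) (form-linear² D-sym e (- d) u w) ⟩
    δ * (e * e * form D u u + + 2 * e * - d * form D u w + - d * - d * form D w w)
      ≡⟨ cong (δ *_) (cong₂ _+_ (cong₂ (λ s t → e * e * s + + 2 * e * - d * t)
           (form-solution D d u x Du≡dx u) (form-solution D e w y Dw≡ey u))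
           (cong (- d * - d *_) (form-solution D e w y Dw≡ey w))) ⟩
    δ * (e * e * (d * (u · x)) + + 2 * e * - d * (e * (u · y)) + - d * - d * (e * (w · y)))
      ≡⟨ identity₁ δ e d a b c (u · x) (u · y) (w · y) ⟩
    e * d * (e * d * (δ * (a + b - + 2 * c)) + + 2 * (e * (C * δ)) - e * (A * δ) - d * (B * δ))
      ≡⟨ cong (e * d *_) (cong₂ _-_ (cong₂ (λ s t → e * d * (δ * (a + b - + 2 * c)) + + 2 * (e * s) - e * t)
           (Cδ 0<e) (sym dα)) (cong (d *_) (sym eβ))) ⟩
    e * d * (e * d * (δ * (a + b - + 2 * c)) + + 2 * (e * (d * γ)) - e * (d * α) - d * (e * β))
      ≡⟨ identity₂ δ e d (a + b - + 2 * c) α β γ ⟩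
    (e * d) * ((e * d) * (δ * (a + b - + 2 * c) + + 2 * γ - α - β)) ∎
    where
    identity₁ : ∀ δ e d a b c p q r →
      δ * (e * e * (d * p) + + 2 * e * - d * (e * q) + - d * - d * (e * r)) ≡
      e * d * (e * d * (δ * (a + b - + 2 * c)) + + 2 * (e * ((d * c - q) * δ)) - e * ((d * a - p) * δ) - d * ((e * b - r) * δ))
    identity₁ = solve-∀
    identity₂ : ∀ δ e d s α β γ →
      e * d * (e * d * (δ * s) + + 2 * (e * (d * γ)) - e * (d * α) - d * (e * β)) ≡
      (e * d) * ((e * d) * (δ * s + + 2 * γ - α - β))
    identity₂ = solve-∀

  -- The vector e u - d w is e d D⁻¹(x - y). `D` sends it to e d (x - y), which is nonzero at `l`,
  -- so it is nonzero itself and its form is positive.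
  gap-positive : PositiveDefinite D → 0ℤ < d → 0ℤ < e → ∀ l → x l ≢ y l →
    0ℤ < δ * (a + b - + 2 * c) + + 2 * γ - α - β
  gap-positive D-pd 0<d 0<e l xl≢yl =
    0<-cancel 0<ed (0<-cancel 0<ed (subst (0ℤ <_) (gap 0<e)
      (0<*0< (0<det D D-sym D-pd) (0<form D D-pd (linear e (- d) u w) λ v≡0 → xl≢yl (xl≡yl v≡0)))))
    where
    0<ed : 0ℤ < e * d
    0<ed = 0<*0< 0<e 0<d

    factor : ∀ e d x y → e * (d * x) + - d * (e * y) ≡ e * d * (x - y)
    factor = solve-∀

    xl≡yl : (∀ i → linear e (- d) u w i ≡ 0ℤ) → x l ≡ y l
    xl≡yl v≡0 = i-j≡0⇒i≡j (x l) (y l) (*-cancelˡ-≡ (e * d) (x l - y l) 0ℤ {{>-nonZero 0<ed}} (begin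
      e * d * (x l - y l)
        ≡⟨ factor e d (x l) (y l) ⟨
      e * (d * x l) + - d * (e * y l)
        ≡⟨ cong₂ (λ s t → e * s + - d * t) (Du≡dx l) (Dw≡ey l) ⟨
      e * D l · u + - d * D l · w
        ≡⟨ ·-linearʳ e (- d) u w (D l) ⟨
      D l · linear e (- d) u w
        ≡⟨ sum-zero (λ i → trans (cong (D l i *_) (v≡0 i)) (*-zeroʳ (D l i))) ⟩
      0ℤ
        ≡⟨ *-zeroʳ (e * d) ⟨
      e * d * 0ℤ ∎))

-- Copying an index within the class, and growth of determinants.

module FixedDiagonal (n : ℤ) (n≡3 : n ≡ + 3 [mod + 4 ]) (3<n : + 3 < n) where

  h : ℤ
  h = n - + 3

  0<h : 0ℤ < h
  0<h = +-monoˡ-< (- + 3) 3<n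

  -- If the new coordinate s is 0, the form is that of `C`. Otherwise `form-copy` gives h (s² + t²)
  -- > 0 plus a nonnegative term.
  copy-ℭ : (C : SqMatrix (ℕ.suc m)) → ℭ n C → 0ℤ ≤ det₃ C → ℭ n (copy n C)
  copy-ℭ {m} C C∈ℭ 0≤det₃ = record
    { symmetric        = bordered-sym symmetric
    ; positiveDefinite = λ z z≢0 → subst (0ℤ <_) (sym (quadraticForm≡form (copy n C) z)) (positive-form z z≢0)
    ; diagonal         = λ { zero → refl ; (suc i) → diagonal i }
    ; congruent        = λ
      { zero          zero          → n≡n
      ; zero          (suc zero)    → 3≡n
      ; zero          (suc (suc j)) → congruent zero (suc j)
      ; (suc zero)    zero          → 3≡n
      ; (suc (suc i)) zero          → congruent zero (suc i)
      ; (suc i)       (suc j)       → congruent i j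
      }
    }
    where
    open ℭ C∈ℭ

    n≡n : n ≡ n [mod + 4 ]
    n≡n = divides 0ℤ (+-inverseʳ n)

    3≡n : + 3 ≡ n [mod + 4 ]
    3≡n = subst (+ 4 ∣_) (negate n) (∣m⇒∣-m n≡3)
      where
      negate : ∀ n → - (n - + 3) ≡ + 3 - n
      negate = solve-∀

    positive-form′ : ∀ z → ¬ (∀ i → z i ≡ 0ℤ) → Dec (z zero ≡ 0ℤ) → 0ℤ < form (copy n C) z z
    positive-form′ z z≢0 (yes s≡0) = subst (0ℤ <_) (sym (form-∷0 n (+ 3 ∷ topRow C) C z s≡0))
      (0<form C positiveDefinite (tail z) λ x≡0 → z≢0 λ { zero → s≡0 ; (suc i) → x≡0 i })
    positive-form′ z z≢0 (no  s≢0) = subst (0ℤ <_)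
      (sym (form-copy C symmetric (diagonal zero) s t x))
      (+-mono-<-≤
        (0<*0< 0<h (+-mono-<-≤ (0<square s≢0) (0≤square t)))
        (bordered-semidefinite (+ 3) (topRow C) {inner C} (λ i j → symmetric (suc i) (suc j))
          (ℭ.positiveDefinite (inner-ℭ C C∈ℭ)) 0≤det₃ ((s + t) ∷ x)))
      where
      s t : ℤ
      s = z zero
      t = z (suc zero)
      x : Vector ℤ m
      x i = z (suc (suc i))

    positive-form : ∀ z → ¬ (∀ i → z i ≡ 0ℤ) → 0ℤ < form (copy n C) z z
    positive-form z z≢0 = positive-form′ z z≢0 (z zero ≟ 0ℤ)

  -- Lowering the corner of the copy from n to 3 subtracts h det C from h (det C + `det₃ C`). Hence
  -- a copy can be copied again.
  det₃-copy : (C : SqMatrix (ℕ.suc m)) → ℭ n C → det₃ (copy n C) ≡ h * det₃ C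
  det₃-copy C C∈ℭ = begin
    det₃ (copy n C)
      ≡⟨ isolate (det₃ (copy n C)) (h * det C) ⟩
    (det₃ (copy n C) + h * det C) - h * det C
      ≡⟨ cong (_- h * det C) (det-det₃ {C = copy n C} (bordered-sym symmetric) refl) ⟨
    det (copy n C) - h * det C
      ≡⟨ cong (_- h * det C) (det-copy C symmetric (diagonal zero)) ⟩
    h * (det C + det₃ C) - h * det C
      ≡⟨ cancel h (det C) (det₃ C) ⟩
    h * det₃ C ∎
    where
    open ℭ C∈ℭ

    isolate : ∀ a b → a ≡ (a + b) - b
    isolate = solve-∀

    cancel : ∀ h a b → h * (a + b) - h * a ≡ h * b
    cancel = solve-∀

  h*det≤det-copy : (C : SqMatrix (ℕ.suc m)) → ℭ n C → 0ℤ ≤ det₃ C → h * det C ≤ det (copy n C)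
  h*det≤det-copy C C∈ℭ 0≤det₃ = subst (h * det C ≤_) (sym (det-copy C symmetric (diagonal zero)))
    (*-monoˡ-≤-nonNeg h {{nonNegative (<⇒≤ 0<h)}}
      (subst (_≤ det C + det₃ C) (+-identityʳ (det C)) (+-monoʳ-≤ (det C) 0≤det₃)))
    where open ℭ C∈ℭ

  module FixedBlock {r : ℕ} (M : SqMatrix (ℕ.suc r)) (0≤det₃M : 0ℤ ≤ det₃ M) where

    -- The position of the fixed block is an arbitrary map `f`, so adding or removing index 0 only
    -- composes it with `suc`.
    record Extends (f : Fin (ℕ.suc r) → Fin m) (F : SqMatrix m) : Set where
      field
        inℭ      : ℭ n F
        restrict : ∀ a b → F (f a) (f b) ≡ M a b

    open Extends

    inner-Extends : ∀ {f} (F : SqMatrix (ℕ.suc m)) → Extends (λ a → suc (f a)) F → Extends f (inner F)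
    inner-Extends F F-ext = record { inℭ = inner-ℭ F (inℭ F-ext) ; restrict = restrict F-ext }

    copy-Extends : ∀ {f} (F : SqMatrix (ℕ.suc m)) → Extends f F → 0ℤ ≤ det₃ F →
      Extends (λ a → suc (f a)) (copy n F)
    copy-Extends F F-ext 0≤det₃ = record
      { inℭ = copy-ℭ F (inℭ F-ext) 0≤det₃ ; restrict = restrict F-ext }

    Extension : ∀ k → SqMatrix (k ℕ.+ ℕ.suc r) → Set
    Extension k = Extends (k ↑ʳ_)

    h*det₃≥0 : ∀ (C : SqMatrix (ℕ.suc m)) → ℭ n C → 0ℤ ≤ det₃ C → 0ℤ ≤ det₃ (copy n C)
    h*det₃≥0 C C∈ℭ 0≤det₃ = subst (0ℤ ≤_) (sym (det₃-copy C C∈ℭ)) (0≤*0≤ (<⇒≤ 0<h) 0≤det₃)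

    -- The sign of `det₃ G` is carried along because it permits the next enlargement to be a plain
    -- copy.
    Growth : ∀ k → SqMatrix (k ℕ.+ ℕ.suc r) → Set
    Growth k F = ∃[ G ] Extension (ℕ.suc k) G × 0ℤ ≤ det₃ G × h * det F ≤ det G

    grow-by-copy : ∀ k (F : SqMatrix (ℕ.suc k ℕ.+ ℕ.suc r)) → Extension (ℕ.suc k) F → 0ℤ ≤ det₃ F →
      Growth (ℕ.suc k) F
    grow-by-copy k F F-ext 0≤det₃ =
      copy n F , copy-Extends F F-ext 0≤det₃ , h*det₃≥0 F (inℭ F-ext) 0≤det₃ , h*det≤det-copy F (inℭ F-ext) 0≤det₃

    grow-again : ∀ k (F : SqMatrix (k ℕ.+ ℕ.suc r)) → Growth k F →
      ∃[ H ] Extension (2 ℕ.+ k) H × 0ℤ ≤ det₃ H × h * (h * det F) ≤ det H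
    grow-again k F (G , G-ext , 0≤det₃ , G-large) =
      copy n G , copy-Extends G G-ext 0≤det₃ , h*det₃≥0 G (inℭ G-ext) 0≤det₃ ,
      ≤-trans (*-monoˡ-≤-nonNeg h {{nonNegative (<⇒≤ 0<h)}} G-large) (h*det≤det-copy G (inℭ G-ext) 0≤det₃)

    det≤h*det-inner : (F : SqMatrix (ℕ.suc m)) → ℭ n F → det₃ F < 0ℤ → det F ≤ h * det (inner F)
    det≤h*det-inner F F∈ℭ det₃<0 = subst₂ _≤_ (sym (det-det₃ {C = F} (ℭ.symmetric F∈ℭ) (ℭ.diagonal F∈ℭ zero)))
      (+-identityˡ (h * det (inner F))) (+-monoˡ-≤ (h * det (inner F)) (<⇒≤ det₃<0))

    -- Index 0 is copied if `det₃ F` is nonnegative. Otherwise det F is at most h det (`inner F`),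
    -- and two enlargements of `inner F` reach the required order with at least h² det (`inner F`).
    -- At k = 0 the matrix is `M`, and `0≤det₃M` applies.
    grow : ∀ k F → Extension k F → Growth k F
    grow-inner : ∀ k F → Extension (ℕ.suc k) F → Dec (0ℤ ≤ det₃ F) → Growth (ℕ.suc k) F
    grow ℕ.zero F F-ext = copy n F , copy-Extends F F-ext 0≤det₃ , h*det₃≥0 F (inℭ F-ext) 0≤det₃ ,
      h*det≤det-copy F (inℭ F-ext) 0≤det₃
      where
      0≤det₃ : 0ℤ ≤ det₃ F
      0≤det₃ = subst (0ℤ ≤_) (sym (det-cong
        (bordered (+ 3) (topRow F) (topRow F) (inner F)) (bordered (+ 3) (topRow M) (topRow M) (inner M))
        λ { zero zero → refl ; zero (suc j) → restrict F-ext zero (suc j)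
          ; (suc i) zero → restrict F-ext zero (suc i) ; (suc i) (suc j) → restrict F-ext (suc i) (suc j) })) 0≤det₃M
    grow (ℕ.suc k) F F-ext = grow-inner k F F-ext (0ℤ ≤? det₃ F)
    grow-inner k F F-ext (yes 0≤det₃) = grow-by-copy k F F-ext 0≤det₃
    grow-inner k F F-ext (no  0≰det₃) =
      let H , H-ext , 0≤det₃ , H-large = grow-again k (inner F) (grow k (inner F) (inner-Extends F F-ext))
      in H , H-ext , 0≤det₃ , ≤-trans
           (*-monoˡ-≤-nonNeg h {{nonNegative (<⇒≤ 0<h)}} (det≤h*det-inner F (inℭ F-ext) (≰⇒> 0≰det₃))) H-large

    -- The contradiction for a maximal matrix, with i and j at indices 0 and 1.

    module Maximal {k} (F : SqMatrix (2 ℕ.+ k ℕ.+ ℕ.suc r)) (F-ext : Extension (2 ℕ.+ k) F)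
      (maximal : ∀ G → Extension (2 ℕ.+ k) G → det G ≤ det F)
      (F₀₁≡3 : F zero (suc zero) ≡ + 3) where

      private
        N : ℕ
        N = k ℕ.+ ℕ.suc r

        x y : Vector ℤ N
        x l = F zero (suc (suc l))
        y l = F (suc zero) (suc (suc l))

        D : SqMatrix N
        D = inner (inner F)

        D-ext : Extension k D
        D-ext = inner-Extends (inner F) (inner-Extends F F-ext)

        D-sym : Symmetric D
        D-sym = ℭ.symmetric (inℭ D-ext)

        F-sym : Symmetric F
        F-sym = ℭ.symmetric (inℭ F-ext)

        F-diag : ∀ i → F i i ≡ n
        F-diag = ℭ.diagonal (inℭ F-ext)

        τ : Permutation (2 ℕ.+ N) (2 ℕ.+ N)
        τ = P.transpose zero (suc zero)

        -- `inner` removes index 0 only, so index 1 is removed by first exchanging the two; this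
        -- does not move the fixed block.
        Fˣ Fʸ : SqMatrix (ℕ.suc N)
        Fˣ = inner (reindex (τ ⟨$⟩ʳ_) F)
        Fʸ = inner F

        Fˣ-ext : Extension (ℕ.suc k) Fˣ
        Fˣ-ext = inner-Extends (reindex (τ ⟨$⟩ʳ_) F) record
          { inℭ = reindex-ℭ τ F (inℭ F-ext) ; restrict = restrict F-ext }

        Fʸ-ext : Extension (ℕ.suc k) Fʸ
        Fʸ-ext = inner-Extends F F-ext

        0<det-Extension : ∀ {m} {f : Fin (ℕ.suc r) → Fin m} (G : SqMatrix m) → Extends f G → 0ℤ < det G
        0<det-Extension G G-ext = 0<det G (ℭ.symmetric (inℭ G-ext)) (ℭ.positiveDefinite (inℭ G-ext))

        Fˣ≋ : Fˣ ≋ bordered n x x D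
        Fˣ≋ zero    zero    = F-diag zero
        Fˣ≋ zero    (suc j) = refl
        Fˣ≋ (suc i) zero    = F-sym (suc (suc i)) zero
        Fˣ≋ (suc i) (suc j) = refl

        Fʸ≋ : Fʸ ≋ bordered n y y D
        Fʸ≋ zero    zero    = F-diag (suc zero)
        Fʸ≋ zero    (suc j) = refl
        Fʸ≋ (suc i) zero    = F-sym (suc (suc i)) (suc zero)
        Fʸ≋ (suc i) (suc j) = refl

        F≋ : F ≋ bordered n (+ 3 ∷ x) (+ 3 ∷ x) (bordered n y y D)
        F≋ zero          zero          = F-diag zero
        F≋ zero          (suc zero)    = F₀₁≡3
        F≋ zero          (suc (suc j)) = refl
        F≋ (suc zero)    zero          = trans (F-sym (suc zero) zero) F₀₁≡3
        F≋ (suc (suc i)) zero          = F-sym (suc (suc i)) zero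
        F≋ (suc i)       (suc j)       = Fʸ≋ i j

        copy-maximal : ∀ G → Extension (ℕ.suc k) G → inner G ≋ D → 0ℤ ≤ det G - h * det D →
          h * (det G + (det G - h * det D)) ≤ det F
        copy-maximal G G-ext inner≋D 0≤ = subst (_≤ det F)
          (trans (det-copy G (ℭ.symmetric (inℭ G-ext)) (ℭ.diagonal (inℭ G-ext) zero))
            (cong (λ t → h * (det G + t)) det₃≡))
          (maximal (copy n G) (copy-Extends G G-ext (subst (0ℤ ≤_) (sym det₃≡) 0≤)))
          where
          cancel : ∀ a b → a ≡ (a + b) - b
          cancel = solve-∀

          det₃≡ : det₃ G ≡ det G - h * det D
          det₃≡ = begin
            det₃ G
              ≡⟨ cancel (det₃ G) (h * det (inner G)) ⟩
            (det₃ G + h * det (inner G)) - h * det (inner G)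
              ≡⟨ cong (_- h * det (inner G)) (det-det₃ {C = G} (ℭ.symmetric (inℭ G-ext)) (ℭ.diagonal (inℭ G-ext) zero)) ⟨
            det G - h * det (inner G)
              ≡⟨ cong (λ t → det G - h * t) (det-cong (inner G) D inner≋D) ⟩
            det G - h * det D ∎

        double : ∀ a b t → t ≤ a + b → b ≤ a → t ≤ a + a
        double a b t t≤a+b b≤a = ≤-trans t≤a+b (+-monoʳ-≤ a b≤a)

        half : ∀ a t → + 2 * t ≤ a + a → 0ℤ ≤ a - t
        half a t 2t≤2a = 0≤-cancel {+ 2} (+<+ (ℕ.s≤s ℕ.z≤n)) (subst (0ℤ ≤_) (distrib a t) (i≤j⇒0≤j-i 2t≤2a))
          where
          distrib : ∀ a t → a + a - + 2 * t ≡ + 2 * (a - t)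
          distrib = solve-∀

        D-pd : PositiveDefinite D
        D-pd = ℭ.positiveDefinite (inℭ D-ext)

        module _ (d : ℤ) (u : Vector ℤ N) (0<d : 0ℤ < d) (Du≡dx : ∀ i → D i · u ≡ d * x i)
                 (e : ℤ) (w : Vector ℤ N) (0<e : 0ℤ < e) (Dw≡ey : ∀ i → D i · w ≡ e * y i) where

          open TwoBorders n n (+ 3) x y D D-sym d u Du≡dx e w Dw≡ey

          0<δ : 0ℤ < δ
          0<δ = 0<det-Extension D D-ext

          αˣ : det Fˣ ≡ α
          αˣ = det-cong Fˣ (bordered n x x D) Fˣ≋

          βʸ : det Fʸ ≡ β
          βʸ = det-cong Fʸ (bordered n y y D) Fʸ≋

          δ*det : δ * det F ≡ α * β - γ * γ
          δ*det = trans (cong (δ *_) (det-cong F E F≋)) (desnanot-jacobi 0<d 0<e)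

          0<T : ∀ l → x l ≢ y l → 0ℤ < + 2 * (h * δ) + + 2 * γ - α - β
          0<T l xl≢yl = subst (0ℤ <_) (rearrange δ n γ α β) (gap-positive D-pd 0<d 0<e l xl≢yl)
            where
            rearrange : ∀ δ n γ α β →
              δ * (n + n - + 2 * + 3) + + 2 * γ - α - β ≡ + 2 * ((n - + 3) * δ) + + 2 * γ - α - β
            rearrange = solve-∀

          sparse-case : α + β < + 2 * (h * δ) → ⊥
          sparse-case α+β<2hδ =
            let H , H-ext , _ , H-large = grow-again k D (grow k D D-ext)
            in sparse-no-gain h δ α β γ (det F) 0<h 0<δ
                 (subst (0ℤ <_) αˣ (0<det-Extension Fˣ Fˣ-ext)) (subst (0ℤ <_) βʸ (0<det-Extension Fʸ Fʸ-ext))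
                 δ*det α+β<2hδ (≤-trans H-large (maximal H H-ext))

          -- The larger of α and β is at least half of their sum, hence at least hδ. This says that
          -- `det₃` of the corresponding one of `Fˣ` and `Fʸ` is nonnegative, so its copy is a
          -- legitimate competitor of `F`.
          dense-case : 0ℤ < + 2 * (h * δ) + + 2 * γ - α - β → + 2 * (h * δ) ≤ α + β → Dec (β ≤ α) → ⊥
          dense-case 0<T 2hδ≤α+β (yes β≤α) = copy-no-gain h δ α β γ (det F) 0<h 0<δ δ*det 0<T 2hδ≤α+β β≤α
            (subst (λ t → h * (t + (t - h * δ)) ≤ det F) αˣ (copy-maximal Fˣ Fˣ-ext (λ i j → refl)
              (subst (λ t → 0ℤ ≤ t - h * δ) (sym αˣ) (half α (h * δ) (double α β (+ 2 * (h * δ)) 2hδ≤α+β β≤α)))))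
          dense-case 0<T 2hδ≤α+β (no  β≰α) = copy-no-gain h δ β α γ (det F) 0<h 0<δ
            (trans δ*det (cong (_- γ * γ) (*-comm α β)))
            (subst (0ℤ <_) (swap (+ 2 * (h * δ) + + 2 * γ) α β) 0<T) 2hδ≤β+α α≤β
            (subst (λ t → h * (t + (t - h * δ)) ≤ det F) βʸ (copy-maximal Fʸ Fʸ-ext (λ i j → refl)
              (subst (λ t → 0ℤ ≤ t - h * δ) (sym βʸ) (half β (h * δ) (double β α (+ 2 * (h * δ)) 2hδ≤β+α α≤β)))))
            where
            α≤β : α ≤ β
            α≤β = <⇒≤ (≰⇒> β≰α)

            2hδ≤β+α : + 2 * (h * δ) ≤ β + α
            2hδ≤β+α = subst (+ 2 * (h * δ) ≤_) (+-comm α β) 2hδ≤α+β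

            swap : ∀ t a b → t - a - b ≡ t - b - a
            swap = solve-∀

          unequal-impossible : ∀ l → x l ≢ y l → Dec (+ 2 * (h * δ) ≤ α + β) → ⊥
          unequal-impossible l xl≢yl (yes 2hδ≤α+β) = dense-case (0<T l xl≢yl) 2hδ≤α+β (β ≤? α)
          unequal-impossible l xl≢yl (no  2hδ≰α+β) = sparse-case (≰⇒> 2hδ≰α+β)

      rows-agree : ∀ l → F zero (suc (suc l)) ≡ F (suc zero) (suc (suc l))
      rows-agree l = decidable-stable (x l ≟ y l) λ xl≢yl →
        let d , u , 0<d , Du≡dx = solve D D-sym D-pd x
            e , w , 0<e , Dw≡ey = solve D D-sym D-pd y
        in unequal-impossible d u 0<d Du≡dx e w 0<e Dw≡ey l xl≢yl (_ ≤? _)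

-- Permutations that bring the given matrix into the form used above.

toFrontₚ : Fin (ℕ.suc m) → Permutation (ℕ.suc m) (ℕ.suc m)
toFrontₚ i = P.insert zero i P.id

-- Once i is taken out, j stands at `punchOut i≢j`, and this is the index to be moved to the front
-- of the rest.
twoToFrontₚ : ∀ {p} {i j : Fin p} → i ≢ j →
  ∃[ m ] Σ[ ρ ∈ Permutation (2 ℕ.+ m) p ] ρ ⟨$⟩ʳ zero ≡ i × ρ ⟨$⟩ʳ suc zero ≡ j
twoToFrontₚ {ℕ.suc ℕ.zero}    {zero} {zero} 0≢0 = contradiction refl 0≢0
twoToFrontₚ {ℕ.suc (ℕ.suc m)} {i}    {j}    i≢j =
  m , P.insert zero i (toFrontₚ (punchOut i≢j)) , refl , punchIn-punchOut i≢j

-- Puts the fixed block behind the free indices, permuting each block on the way: `ρ` brings i and j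
-- to the front, `σ` the last index of the fixed block to its front.
blockSwapₚ : ∀ {s t} → Permutation p q → Permutation s t → Permutation (p ℕ.+ s) (t ℕ.+ q)
blockSwapₚ ρ σ = ↔-trans +↔⊎ (↔-trans (ρ ⊎-↔ σ) (↔-trans (⊎-comm _ _) (↔-sym +↔⊎)))

module _ {s t} (ρ : Permutation p q) (σ : Permutation s t) where

  blockSwapₚ-↑ˡ : ∀ i → blockSwapₚ ρ σ ⟨$⟩ʳ (i ↑ˡ s) ≡ t ↑ʳ (ρ ⟨$⟩ʳ i)
  blockSwapₚ-↑ˡ i rewrite splitAt-↑ˡ p i s = refl

  blockSwapₚ-↑ʳ : ∀ i → blockSwapₚ ρ σ ⟨$⟩ʳ (p ↑ʳ i) ≡ (σ ⟨$⟩ʳ i) ↑ˡ q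
  blockSwapₚ-↑ʳ i rewrite splitAt-↑ʳ p s i = refl

  blockSwapₚ⁻¹-↑ˡ : ∀ i → blockSwapₚ ρ σ ⟨$⟩ˡ (i ↑ˡ q) ≡ p ↑ʳ (σ ⟨$⟩ˡ i)
  blockSwapₚ⁻¹-↑ˡ i rewrite splitAt-↑ˡ t i q = refl

↑ˡ≢↑ʳ : ∀ (i : Fin p) (j : Fin q) → i ↑ˡ q ≢ p ↑ʳ j
↑ˡ≢↑ʳ {p} {q} i j eq
  with () ← trans (sym (splitAt-↑ˡ p i q)) (trans (cong (splitAt p) eq) (splitAt-↑ʳ p q j))

lastFirst : SqMatrix (ℕ.suc m) → SqMatrix (ℕ.suc m)
lastFirst {m} M = reindex (toFrontₚ (fromℕ m) ⟨$⟩ʳ_) M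

-- Moving the last index to the front carries the altered entry of `tilde M` to the corner, and a
-- simultaneous permutation of rows and columns preserves the determinant.
det₃-lastFirst : (M : SqMatrix (ℕ.suc m)) → Symmetric M → det₃ (lastFirst M) ≡ det (tilde M)
det₃-lastFirst {m} M M-sym = trans
  (det-cong (bordered (+ 3) (topRow M′) (topRow M′) (inner M′)) (reindex (toFrontₚ l ⟨$⟩ʳ_) (tilde M))
    λ { zero    zero    → sym (trans (cong (_$ l) (updateAt-updates l M)) (updateAt-updates l (M l)))
      ; zero    (suc j) → sym (trans (cong (_$ punchIn l j) (updateAt-updates l M))
                            (updateAt-minimal (punchIn l j) l (M l) (punchInᵢ≢i l j)))
      ; (suc i) zero    → trans (M-sym l (punchIn l i)) (sym (unchanged i l))
      ; (suc i) (suc j) → sym (unchanged i (punchIn l j)) })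
  (det-reindex (toFrontₚ l) (tilde M))
  where
  l : Fin (ℕ.suc m)
  l = fromℕ m

  M′ : SqMatrix (ℕ.suc m)
  M′ = lastFirst M

  unchanged : ∀ i j → tilde M (punchIn l i) j ≡ M (punchIn l i) j
  unchanged i j = cong (_$ j) (updateAt-minimal (punchIn l i) l M (punchInᵢ≢i l i))

theorem9 :
    ∀ (n : ℤ) → n ≡ + 3 [mod + 4 ] → + 3 < n →
    ∀ (r k : ℕ) (M : SqMatrix (ℕ.suc r)) → ℭ n M → 0ℤ < det (tilde M) →
    ∀ (E* : SqMatrix (ℕ.suc r ℕ.+ k)) → MaximalDet n M E* →
    let B = topRight (ℕ.suc r) E*
        A = bottomRight (ℕ.suc r) E*
    in ∀ (i j : Fin k) → i ≢ j → A i j ≡ + 3 →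
       (∀ (l : Fin (ℕ.suc r)) → B l i ≡ B l j) ×
       (∀ (l : Fin k) → l ≢ i → l ≢ j → A l i ≡ A l j)
theorem9 n n≡3 3<n r k M M∈ℭ 0<det~ E* (E*∈𝔈 , E*-max) i j i≢j Aij≡3 =
  (λ l → columns-agree (l ↑ˡ k) (↑ˡ≢↑ʳ l i) (↑ˡ≢↑ʳ l j)) ,
  (λ l l≢i l≢j → columns-agree (R ↑ʳ l) (l≢i ∘ ↑ʳ-injective R l i) (l≢j ∘ ↑ʳ-injective R l j))
  where
  R : ℕ
  R = ℕ.suc r

  M-sym : Symmetric M
  M-sym = ℭ.symmetric M∈ℭ

  E*∈ℭ : ℭ n E*
  E*∈ℭ = 𝔈.inℭ E*∈𝔈

  k′ : ℕ
  k′ = proj₁ (twoToFrontₚ i≢j)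

  ρ : Permutation (2 ℕ.+ k′) k
  ρ = proj₁ (proj₂ (twoToFrontₚ i≢j))

  σ : Permutation R R
  σ = toFrontₚ (fromℕ r)

  π : Permutation (2 ℕ.+ k′ ℕ.+ R) (R ℕ.+ k)
  π = blockSwapₚ ρ σ

  πzero : π ⟨$⟩ʳ zero ≡ R ↑ʳ i
  πzero = trans (blockSwapₚ-↑ˡ ρ σ zero) (cong (R ↑ʳ_) (proj₁ (proj₂ (proj₂ (twoToFrontₚ i≢j)))))

  πone : π ⟨$⟩ʳ suc zero ≡ R ↑ʳ j
  πone = trans (blockSwapₚ-↑ˡ ρ σ (suc zero)) (cong (R ↑ʳ_) (proj₂ (proj₂ (proj₂ (twoToFrontₚ i≢j)))))

  M′ : SqMatrix R
  M′ = lastFirst M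

  open FixedDiagonal n n≡3 3<n
  open FixedBlock M′ (subst (0ℤ ≤_) (sym (det₃-lastFirst M M-sym)) (<⇒≤ 0<det~))

  F : SqMatrix (2 ℕ.+ k′ ℕ.+ R)
  F = reindex (π ⟨$⟩ʳ_) E*

  F-ext : Extension (2 ℕ.+ k′) F
  F-ext = record
    { inℭ      = reindex-ℭ π E* E*∈ℭ
    ; restrict = λ a b → trans (cong₂ E* (blockSwapₚ-↑ʳ ρ σ a) (blockSwapₚ-↑ʳ ρ σ b))
        (𝔈.leading E*∈𝔈 (σ ⟨$⟩ʳ a) (σ ⟨$⟩ʳ b))
    }

  -- A competitor `G` is carried back along the inverse of `π`, where its fixed block becomes the
  -- leading block `M` again; neither determinant changes.
  F-max : ∀ G → Extension (2 ℕ.+ k′) G → det G ≤ det F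
  F-max G G-ext = subst₂ _≤_ (det-reindex (P.flip π) G) (sym (det-reindex π E*))
    (E*-max (reindex (π ⟨$⟩ˡ_) G) record
      { inℭ     = reindex-ℭ (P.flip π) G (Extends.inℭ G-ext)
      ; leading = λ a b → trans (cong₂ G (blockSwapₚ⁻¹-↑ˡ ρ σ a) (blockSwapₚ⁻¹-↑ˡ ρ σ b))
          (trans (Extends.restrict G-ext (σ ⟨$⟩ˡ a) (σ ⟨$⟩ˡ b)) (cong₂ M (inverseʳ σ) (inverseʳ σ)))
      })

  rows-agree-at : ∀ c → c ≢ zero → c ≢ suc zero → F zero c ≡ F (suc zero) c
  rows-agree-at zero          c≢0 c≢1 = contradiction refl c≢0
  rows-agree-at (suc zero)    c≢0 c≢1 = contradiction refl c≢1
  rows-agree-at (suc (suc c)) c≢0 c≢1 =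
    Maximal.rows-agree {k = k′} F F-ext F-max (trans (cong₂ E* πzero πone) Aij≡3) c

  -- Covers the columns of B and of A at once: symmetry turns columns into rows, and `b` corresponds
  -- under `π` to an index other than 0 and 1.
  columns-agree : ∀ b → b ≢ R ↑ʳ i → b ≢ R ↑ʳ j → E* b (R ↑ʳ i) ≡ E* b (R ↑ʳ j)
  columns-agree b b≢i b≢j = begin
    E* b (R ↑ʳ i)                       ≡⟨ ℭ.symmetric E*∈ℭ b (R ↑ʳ i) ⟩
    E* (R ↑ʳ i) b                       ≡⟨ cong₂ E* πzero (inverseʳ π) ⟨
    F zero (π ⟨$⟩ˡ b)                   ≡⟨ rows-agree-at (π ⟨$⟩ˡ b) (π⁻¹b≢ πzero b≢i) (π⁻¹b≢ πone b≢j) ⟩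
    F (suc zero) (π ⟨$⟩ˡ b)             ≡⟨ cong₂ E* πone (inverseʳ π) ⟩
    E* (R ↑ʳ j) b                       ≡⟨ ℭ.symmetric E*∈ℭ (R ↑ʳ j) b ⟩
    E* b (R ↑ʳ j)                       ∎
    where
    π⁻¹b≢ : ∀ {a c} → π ⟨$⟩ʳ a ≡ c → b ≢ c → π ⟨$⟩ˡ b ≢ a
    π⁻¹b≢ πa≡c b≢c π⁻¹b≡a = b≢c (trans (sym (inverseʳ π)) (trans (cong (π ⟨$⟩ʳ_) π⁻¹b≡a) πa≡c))
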